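{- Let $G$ be a finite simple graph on $n$ vertices. If $\delta(G)\geq \tilde\alpha(G)$, then $G$ is pancyclic, unless $G$ is the complete bipartite graph $K_{\frac{n}{2},\frac{n}{2}}$.
   Context: $\delta(G)$ denotes the minimum degree of $G$. The bipartite independence number $\tilde\alpha(G)$ is the minimal number $k$ such that there exist positive integers $a$ and $b$ with $a+b=k+1$ with the property that for any two disjoint sets $A,B\subseteq V(G)$ with $|A|=a$ and $|B|=b$, there is an edge of $G$ between $A$ and $B$. An $n$-vertex graph is pancyclic if it contains a cycle of length $\ell$ for every integer $\ell$ with $3\leq \ell\leq n$. -}

module Defs where

open import Data.Empty using (⊥)
open import Data.Fin using (Fin; toℕ; splitAt)
open import Data.Fin.Properties using (any?)
open import Data.Fin.Subset using (Subset; _∈_; _∩_; ∣_∣; Empty)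
open import Data.Fin.Subset.Properties using (_∈?_; nonempty?; anySubset?; ∣p∣≤n)
open import Data.List using (map; allFin)
open import Data.List.Extrema.Nat using (min)
open import Data.Nat using (ℕ; suc; _+_; _*_; _≤_; _<_; z≤n; s≤s; _≟_; _<?_)
open import Data.Nat.Properties
  using (anyUpTo?; +-comm; m≤m+n; m≤n+m; ≤-reflexive; ≤-trans; ≮⇒≥; n≮n)
open import Data.Nat.Induction using (<-rec)
open import Data.Product using (∃; ∃-syntax; _×_; _,_; proj₁; proj₂)
open import Data.Sum using (_⊎_; inj₁; inj₂)
open import Data.Unit using (⊤; tt)
open import Data.Vec using (tabulate)
open import Function.Base using (_∘_)
open import Function.Bundles using (_↔_; _⇔_; Inverse)
open import Function.Definitions using (Injective)
open import Level using (0ℓ)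
open import Relation.Binary.Core using (Rel)
open import Relation.Binary.Definitions using (Decidable; Symmetric; Irreflexive)
open import Relation.Binary.PropositionalEquality using (_≡_; refl; cong; subst)
open import Relation.Nullary using (Dec; yes; no; does; contradiction)
open import Relation.Nullary.Decidable
  using (map′; ¬?; _×-dec_; _→-dec_; decidable-stable)
import Relation.Unary as U

-- Adjacency is decidable, so that degrees and α̃ below are computable.

record Graph (n : ℕ) : Set₁ where
  field
    Adj        : Rel (Fin n) 0ℓ
    adj?       : Decidable Adj
    adj-sym    : Symmetric Adj
    adj-irrefl : Irreflexive _≡_ Adj

open Graph public

private variable
  m n : ℕ

neighbours : Graph n → Fin n → Subset n
neighbours G v = tabulate (λ w → does (adj? G v w))

degree : Graph n → Fin n → ℕ
degree G v = ∣ neighbours G v ∣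

-- Every degree is below n, so the default value n is only reached
-- when there are no vertices.

δ : Graph n → ℕ
δ {n} G = min n (map (degree G) (allFin n))

EdgeBetween : Graph n → Subset n → Subset n → Set
EdgeBetween G A B = ∃[ x ] ∃[ y ] x ∈ A × y ∈ B × Adj G x y

AllPairsJoined : Graph n → ℕ → ℕ → Set
AllPairsJoined {n} G a b =
  (A B : Subset n) → Empty (A ∩ B) → ∣ A ∣ ≡ a → ∣ B ∣ ≡ b → EdgeBetween G A B

HasJoinedSplit : Graph n → ℕ → Set
HasJoinedSplit G k =
  ∃[ a ] ∃[ b ] 0 < a × 0 < b × a + b ≡ suc k × AllPairsJoined G a b

IsLeast : (ℕ → Set) → ℕ → Set
IsLeast P k = P k × (∀ j → P j → k ≤ j)

least : {P : ℕ → Set} → U.Decidable P → ∀ k → P k → ∃ (IsLeast P)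
least {P} P? = <-rec (λ k → P k → ∃ (IsLeast P)) step
  where
  step : ∀ k → (∀ {j} → j < k → P j → ∃ (IsLeast P)) → P k → ∃ (IsLeast P)
  step k rec Pk with anyUpTo? P? k
  ... | yes (j , j<k , Pj) = rec j<k Pj
  ... | no ¬∃ = k , Pk , λ j Pj → ≮⇒≥ (λ j<k → ¬∃ (j , j<k , Pj))

edgeBetween? : (G : Graph n) (A B : Subset n) → Dec (EdgeBetween G A B)
edgeBetween? G A B =
  any? λ x → any? λ y → (x ∈? A) ×-dec ((y ∈? B) ×-dec adj? G x y)

allSubset? : {P : Subset n → Set} → U.Decidable P → Dec (∀ A → P A)
allSubset? P? = map′
  (λ ¬∃ A → decidable-stable (P? A) (λ ¬PA → ¬∃ (A , ¬PA)))
  (λ ∀P (A , ¬PA) → ¬PA (∀P A))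
  (¬? (anySubset? (¬? ∘ P?)))

allPairsJoined? : (G : Graph n) → ∀ a b → Dec (AllPairsJoined G a b)
allPairsJoined? G a b = allSubset? λ A → allSubset? λ B →
  ¬? (nonempty? (A ∩ B)) →-dec
  ((∣ A ∣ ≟ a) →-dec ((∣ B ∣ ≟ b) →-dec edgeBetween? G A B))

hasJoinedSplit? : (G : Graph n) → U.Decidable (HasJoinedSplit G)
hasJoinedSplit? G k = map′
  (λ (a , _ , b , _ , p) → a , b , p)
  (λ (a , b , p@(_ , _ , a+b≡ , _)) →
    a , s≤s (≤-trans (m≤m+n a b) (≤-reflexive a+b≡)) ,
    b , s≤s (≤-trans (m≤n+m b a) (≤-reflexive a+b≡)) , p)
  (anyUpTo? (λ a → anyUpTo? (λ b →
    (0 <? a) ×-dec ((0 <? b) ×-dec ((a + b ≟ suc k) ×-dec allPairsJoined? G a b)))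
    (suc (suc k))) (suc (suc k)))

-- No set has n + 1 vertices, so a = n + 1 and b = 1 work vacuously.

hasJoinedSplit-suc : (G : Graph n) → HasJoinedSplit G (suc n)
hasJoinedSplit-suc {n} G =
  suc n , 1 , s≤s z≤n , s≤s z≤n , cong suc (+-comm n 1) ,
  λ A _ _ ∣A∣≡ _ → contradiction (subst (_≤ n) ∣A∣≡ (∣p∣≤n A)) (n≮n n)

α̃-exists : (G : Graph n) → ∃ (IsLeast (HasJoinedSplit G))
α̃-exists {n} G = least (hasJoinedSplit? G) (suc n) (hasJoinedSplit-suc G)

α̃ : Graph n → ℕ
α̃ G = proj₁ (α̃-exists G)

α̃-isLeast : (G : Graph n) → IsLeast (HasJoinedSplit G) (α̃ G)
α̃-isLeast G = proj₂ (α̃-exists G)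

record Cycle (G : Graph n) (ℓ : ℕ) : Set where
  field
    3≤ℓ         : 3 ≤ ℓ
    vertex      : Fin ℓ → Fin n
    injective   : Injective _≡_ _≡_ vertex
    consecutive : ∀ i j → toℕ j ≡ suc (toℕ i) → Adj G (vertex i) (vertex j)
    closing     : ∀ i j → suc (toℕ i) ≡ ℓ → toℕ j ≡ 0 → Adj G (vertex i) (vertex j)

Pancyclic : Graph n → Set
Pancyclic {n} G = ∀ ℓ → 3 ≤ ℓ → ℓ ≤ n → Cycle G ℓ

record _≅_ (G : Graph m) (H : Graph n) : Set where
  field
    bijection : Fin m ↔ Fin n
    preserves : ∀ x y → Adj G x y ⇔ Adj H (Inverse.to bijection x) (Inverse.to bijection y)

OppositeSides : {A B : Set} → Rel (A ⊎ B) 0ℓ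
OppositeSides (inj₁ _) (inj₁ _) = ⊥
OppositeSides (inj₁ _) (inj₂ _) = ⊤
OppositeSides (inj₂ _) (inj₁ _) = ⊤
OppositeSides (inj₂ _) (inj₂ _) = ⊥

oppositeSides? : {A B : Set} → Decidable (OppositeSides {A} {B})
oppositeSides? (inj₁ _) (inj₁ _) = no λ ()
oppositeSides? (inj₁ _) (inj₂ _) = yes tt
oppositeSides? (inj₂ _) (inj₁ _) = yes tt
oppositeSides? (inj₂ _) (inj₂ _) = no λ ()

oppositeSides-sym : {A B : Set} → Symmetric (OppositeSides {A} {B})
oppositeSides-sym {x = inj₁ _} {inj₂ _} _ = tt
oppositeSides-sym {x = inj₂ _} {inj₁ _} _ = tt

oppositeSides-irrefl : {A B : Set} → Irreflexive _≡_ (OppositeSides {A} {B})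
oppositeSides-irrefl {x = inj₁ _} refl ()
oppositeSides-irrefl {x = inj₂ _} refl ()

K : (a b : ℕ) → Graph (a + b)
K a b = record
  { Adj        = λ x y → OppositeSides (splitAt a x) (splitAt a y)
  ; adj?       = λ x y → oppositeSides? (splitAt a x) (splitAt a y)
  ; adj-sym    = λ {x} {y} → oppositeSides-sym {x = splitAt a x} {splitAt a y}
  ; adj-irrefl = λ { {x} refl → oppositeSides-irrefl {x = splitAt a x} refl }
  }

IsBalancedCompleteBipartite : Graph n → Set
IsBalancedCompleteBipartite {n} G = ∃[ k ] n ≡ 2 * k × G ≅ K k k

{-# OPTIONS --safe #-}

-- Let a ≤ b with a + b = α̃ + 1 be such that disjoint sets of sizes a and b are always joined.  Two
-- sets A and B without an edge between them, of sizes at least a and b, have |A ∪ B| < a + b; so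
-- independent sets have at most α̃ elements, and neighbourhoods are as large as that.
--
-- If there is no triangle, then N(v) is a largest independent set, every vertex outside N(v) has at
-- least b neighbours in it, and adjacent ones share a neighbour: G is bipartite, hence K_{k,k}.
--
-- If there is a cycle C of length ℓ < n but none of length ℓ + 1, write v⁺ for the successor on C and
-- T(v) for the neighbours of v off C.  By rotating C along chords, T(z⁺) has no edge to the successors
-- of the neighbours of z on C; so either all |T(z)| are at least a, or all are less than a.
-- In the first case, taking |T(z)| minimal, T(z⁺) also has no edge to T(z⁻), and counting forces
-- T(z⁺) ⊆ T(z⁻).  In the second case, adjacent x and u off C that see C have few neighbours off C;
-- with S(x) = N(x) ∩ C, the only edges from T(x) ∪ S(u)⁺ to S(x)⁺⁺ are v⁺v⁺⁺ with v in both, and since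
-- |T(x)| + |S(x)| ≥ α̃ this forces S(u) to consist of successors of S(x), and conversely.
-- In both cases a vertex off C that sees v also sees v⁻⁻, so its neighbours alternate on C, and the
-- alternation determines a bipartition of the whole graph.

module Submission where

open import Defs
open import Data.Empty using (⊥)
open import Data.Fin using (Fin; zero; suc; toℕ; fromℕ<; splitAt; join)
open import Data.Fin.Permutation using (permutation)
open import Data.Fin.Properties
  using (_≟_; any?; +↔⊎; splitAt-join; toℕ-injective; toℕ-fromℕ<; fromℕ<-injective; injective⇒≤)
import Data.Fin.Subset as Sub
open import Data.Fin.Subset.Properties using (x∈p∩q⁻; ∩-comm)
open import Data.List using (List; []; _∷_; _++_; length; lookup)
open import Data.List.Extrema.Nat using (min≤xs)
open import Data.List.Membership.Propositional using () renaming (_∈_ to _∈ₗ_)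
open import Data.List.Membership.Propositional.Properties using (∈-lookup; ∈-map⁺; ∈-allFin)
open import Data.List.Properties using (length-++)
open import Data.List.Relation.Unary.All as All using (All; []; _∷_)
import Data.List.Relation.Unary.All.Properties as Allₚ
open import Data.List.Relation.Unary.AllPairs using ([]; _∷_)
open import Data.List.Relation.Unary.Unique.DecPropositional using (unique?)
open import Data.List.Relation.Unary.Unique.Propositional using (Unique)
import Data.List.Relation.Unary.Unique.Propositional.Properties as Uniqueₚ
open import Data.Bool using (if_then_else_; true; false)
open import Data.Nat
  using (ℕ; zero; suc; _+_; _*_; _≤_; _<_; _≥_; z≤n; s≤s; _≤?_; _%_; _/_) renaming (_≟_ to _≟ℕ_)
open import Data.Nat.DivMod
  using (_mod_; m≡m%n+[m/n]*n; m%n<n; m<n⇒m%n≡m; n%n≡0; [m+n]%n≡m%n; [m+kn]%n≡m%n)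
open import Data.Nat.Properties hiding (_≟_)
open import Data.Nat.Solver using (module +-*-Solver)
open import Data.Product using (∃; ∃-syntax; _×_; _,_; proj₁; proj₂)
open import Data.Sum as Sum using (_⊎_; inj₁; inj₂)
open import Data.Unit using (tt)
open import Data.Vec using (tabulate)
open import Data.Vec.Properties using (lookup∘tabulate; []=⇒lookup)
open import Function.Base using (_∘_; id)
open import Function.Bundles using (mk↔ₛ′; mk⇔; Inverse)
open import Function.Definitions using (Injective)
open import Level using (0ℓ)
open import Relation.Binary.PropositionalEquality
  using (_≡_; _≢_; refl; sym; trans; cong; cong₂; subst; subst₂; module ≡-Reasoning)
open import Relation.Nullary using (Dec; yes; no; does; ¬_; contradiction)
open import Relation.Nullary.Decidable using (_×-dec_; _⊎-dec_; ¬?; decidable-stable; map′)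
import Relation.Unary as U
open import Algebra.Properties.CommutativeMonoid.Sum +-0-commutativeMonoid
  using (sum; sum-permute; ∑-distrib-+)

open +-*-Solver using (solve; _:+_; _:*_; _:=_; con)

private variable
  n : ℕ

-- Decidable sets of vertices and their sizes

-- `Mem` is implicit, so a set is written as its decision procedure, and membership in a union or
-- difference unfolds to a sum or product of proofs. `∈-tabulate⁻` connects these sets with the
-- subsets of the joining hypothesis.
record FinSet (n : ℕ) : Set₁ where
  constructor ⟦_⟧
  field
    {Mem} : U.Pred (Fin n) 0ℓ
    mem?  : U.Decidable Mem

open FinSet

infix 4 _∈_ _⊆_
infixr 6 _∪_ _∩_
infix 5 _∖_

_∈_ : Fin n → FinSet n → Set
v ∈ A = Mem A v

_⊆_ : FinSet n → FinSet n → Set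
A ⊆ B = ∀ {v} → v ∈ A → v ∈ B

Disjoint : FinSet n → FinSet n → Set
Disjoint A B = ∀ {v} → v ∈ A → ¬ v ∈ B

_∪_ _∩_ _∖_ : FinSet n → FinSet n → FinSet n
A ∪ B = ⟦ (λ v → mem? A v ⊎-dec mem? B v) ⟧
A ∩ B = ⟦ (λ v → mem? A v ×-dec mem? B v) ⟧
A ∖ B = ⟦ (λ v → mem? A v ×-dec ¬? (mem? B v)) ⟧

∁ : FinSet n → FinSet n
∁ A = ⟦ (λ v → ¬? (mem? A v)) ⟧

｛_｝ : Fin n → FinSet n
｛ u ｝ = ⟦ (λ v → v ≟ u) ⟧

preimage : ∀ {m} → (Fin m → Fin n) → FinSet n → FinSet m
preimage f A = ⟦ (λ v → mem? A (f v)) ⟧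

tail : FinSet (suc n) → FinSet n
tail = preimage suc

indicator : {P : Set} → Dec P → ℕ
indicator d = if does d then 1 else 0

# : FinSet n → ℕ
# A = sum (indicator ∘ mem? A)

sum-mono : ∀ {n} {f g : Fin n → ℕ} → (∀ v → f v ≤ g v) → sum f ≤ sum g
sum-mono {zero}  f≤g = z≤n
sum-mono {suc n} f≤g = +-mono-≤ (f≤g zero) (sum-mono (f≤g ∘ suc))

#-mono : {A B : FinSet n} → A ⊆ B → # A ≤ # B
#-mono {A = A} {B} A⊆B = sum-mono λ v → pointwise v (mem? A v) (mem? B v)
  where
  pointwise : ∀ v (a : Dec (v ∈ A)) (b : Dec (v ∈ B)) → indicator a ≤ indicator b
  pointwise v (no _)  _        = z≤n
  pointwise v (yes p) (yes _)  = ≤-refl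
  pointwise v (yes p) (no v∉B) = contradiction (A⊆B p) v∉B

#-subadditive : {A B C : FinSet n} → (∀ {v} → v ∈ A → v ∈ B ⊎ v ∈ C) → # A ≤ # B + # C
#-subadditive {A = A} {B} {C} A⊆ = ≤-trans
  (sum-mono λ v → pointwise v (mem? A v) (mem? B v) (mem? C v))
  (≤-reflexive (∑-distrib-+ (indicator ∘ mem? B) (indicator ∘ mem? C)))
  where
  pointwise : ∀ v (a : Dec (v ∈ A)) (b : Dec (v ∈ B)) (c : Dec (v ∈ C)) →
              indicator a ≤ indicator b + indicator c
  pointwise v (no _)  _        _        = z≤n
  pointwise v (yes _) (yes _)  _        = s≤s z≤n
  pointwise v (yes _) (no _)   (yes _)  = ≤-refl
  pointwise v (yes p) (no v∉B) (no v∉C) with A⊆ p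
  ... | inj₁ v∈B = contradiction v∈B v∉B
  ... | inj₂ v∈C = contradiction v∈C v∉C

#-superadditive : {A B C : FinSet n} → Disjoint A B → A ⊆ C → B ⊆ C → # A + # B ≤ # C
#-superadditive {A = A} {B} {C} dis A⊆C B⊆C = ≤-trans
  (≤-reflexive (sym (∑-distrib-+ (indicator ∘ mem? A) (indicator ∘ mem? B))))
  (sum-mono λ v → pointwise v (mem? A v) (mem? B v) (mem? C v))
  where
  pointwise : ∀ v (a : Dec (v ∈ A)) (b : Dec (v ∈ B)) (c : Dec (v ∈ C)) →
              indicator a + indicator b ≤ indicator c
  pointwise v (no _)  (no _)  _        = z≤n
  pointwise v (yes p) (yes q) _        = contradiction q (dis p)
  pointwise v (yes _) (no _)  (yes _)  = ≤-refl
  pointwise v (yes p) (no _)  (no v∉C) = contradiction (A⊆C p) v∉C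
  pointwise v (no _)  (yes _) (yes _)  = ≤-refl
  pointwise v (no _)  (yes q) (no v∉C) = contradiction (B⊆C q) v∉C

#-∪ : {A B : FinSet n} → Disjoint A B → # A + # B ≤ # (A ∪ B)
#-∪ {A = A} {B} dis = #-superadditive {A = A} {B} {A ∪ B} dis inj₁ inj₂

#-preimage : (f g : Fin n → Fin n) → (∀ v → f (g v) ≡ v) → (∀ v → g (f v) ≡ v) →
             (A : FinSet n) → # (preimage f A) ≡ # A
#-preimage f g fg gf A = sym (sum-permute (indicator ∘ mem? A) (permutation f g fg gf))

#-inhabited : (A : FinSet n) → 1 ≤ # A → ∃ (_∈ A)
#-inhabited {suc n} A 1≤# with mem? A zero
... | yes p = zero , p
... | no  _ with #-inhabited (tail A) 1≤#
...   | v , p = suc v , p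

#-∅ : {A : FinSet n} → (∀ {v} → ¬ v ∈ A) → # A ≡ 0
#-∅ {A = A} empty with # A in eq
... | zero  = refl
... | suc m = contradiction (proj₂ (#-inhabited A (subst (1 ≤_) (sym eq) (s≤s z≤n)))) empty

#-｛｝ : (u : Fin n) → # ｛ u ｝ ≡ 1
#-｛｝ {suc n} zero    = cong suc (#-∅ {n = n} {A = tail ｛ zero ｝} λ ())
#-｛｝ {suc n} (suc u) = ≤-antisym
  (≤-trans (#-mono {A = tail ｛ suc u ｝} {｛ u ｝} λ { refl → refl }) (≤-reflexive (#-｛｝ u)))
  (≤-trans (≤-reflexive (sym (#-｛｝ u))) (#-mono {A = ｛ u ｝} {tail ｛ suc u ｝} (cong suc)))

#-positive : (A : FinSet n) {v : Fin n} → v ∈ A → 1 ≤ # A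
#-positive A {v} v∈A =
  ≤-trans (≤-reflexive (sym (#-｛｝ v))) (#-mono {A = ｛ v ｝} {A} λ { refl → v∈A })

#-∁ : ∀ {n} (A : FinSet n) → # A + # (∁ A) ≡ n
#-∁ {zero}  A = refl
#-∁ {suc n} A with mem? A zero
... | yes _ = cong suc (#-∁ (tail A))
... | no  _ = trans (+-suc (# (tail A)) (# (∁ (tail A)))) (cong suc (#-∁ (tail A)))

⊆-by-size : (A B : FinSet n) → A ⊆ B → # B ≤ # A → B ⊆ A
⊆-by-size A B A⊆B #B≤#A {v} v∈B = decidable-stable (mem? A v) λ v∉A →
  <⇒≱ (≤-trans (≤-reflexive (cong (_+ # A) (sym (#-｛｝ v))))
        (#-superadditive {A = ｛ v ｝} {A} {B} (λ { refl → v∉A }) (λ { refl → v∈B }) A⊆B))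
      #B≤#A

#-missing : (A B : FinSet n) → # A < # B → ∃[ v ] v ∈ B × ¬ v ∈ A
#-missing A B #A<#B with #-inhabited (B ∖ A) (+-cancelˡ-≤ (# A) 1 (# (B ∖ A)) (begin
    # A + 1              ≡⟨ +-comm (# A) 1 ⟩
    suc (# A)            ≤⟨ #A<#B ⟩
    # B                  ≤⟨ #-subadditive {A = B} {A} {B ∖ A} split ⟩
    # A + # (B ∖ A)      ∎))
  where
  open ≤-Reasoning
  split : ∀ {v} → v ∈ B → v ∈ A ⊎ v ∈ B ∖ A
  split {v} v∈B with mem? A v
  ... | yes v∈A = inj₁ v∈A
  ... | no  v∉A = inj₂ (v∈B , v∉A)
... | v , v∈B , v∉A = v , v∈B , v∉A

-- Missing elements of `B` are added one at a time. The lower bound `A` serves to force chosen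
-- vertices into a set of exactly `a` elements, the size that the joining hypothesis requires.
between : (A B : FinSet n) (m : ℕ) → A ⊆ B → # A ≤ m → m ≤ # B →
          ∃[ M ] A ⊆ M × M ⊆ B × # M ≡ m
between A B m A⊆B #A≤m m≤#B with m≤n⇒∃[o]m+o≡n #A≤m
... | d , refl = grow A d A⊆B m≤#B
  where
  grow : ∀ A d → A ⊆ B → # A + d ≤ # B → ∃[ M ] A ⊆ M × M ⊆ B × # M ≡ # A + d
  grow A zero    A⊆B _    = A , (λ v∈A → v∈A) , A⊆B , sym (+-identityʳ (# A))
  grow A (suc d) A⊆B A+d≤
    with #-missing A B (≤-trans (s≤s (m≤m+n (# A) d)) (≤-trans (≤-reflexive (sym (+-suc (# A) d))) A+d≤))
  ... | u , u∈B , u∉A = extend (grow (｛ u ｝ ∪ A) d (λ { (inj₁ refl) → u∈B ; (inj₂ v∈A) → A⊆B v∈A })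
                                 (≤-trans (≤-reflexive (sym size)) A+d≤))
    where
    size : # A + suc d ≡ # (｛ u ｝ ∪ A) + d
    size = trans (+-suc (# A) d) (cong (_+ d) (≤-antisym
      (≤-trans (≤-reflexive (cong (_+ # A) (sym (#-｛｝ u)))) (#-∪ {A = ｛ u ｝} {A} λ { refl → u∉A }))
      (≤-trans (#-subadditive {A = ｛ u ｝ ∪ A} {｛ u ｝} {A} λ v∈ → v∈)
               (≤-reflexive (cong (_+ # A) (#-｛｝ u))))))
    extend : ∃[ M ] ｛ u ｝ ∪ A ⊆ M × M ⊆ B × # M ≡ # (｛ u ｝ ∪ A) + d →
             ∃[ M ] A ⊆ M × M ⊆ B × # M ≡ # A + suc d
    extend (M , ⊆M , M⊆B , #M) = M , (λ v∈A → ⊆M (inj₂ v∈A)) , M⊆B , trans #M (sym size)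

∣tabulate∣ : ∀ {n} (A : FinSet n) → Sub.∣ tabulate (does ∘ mem? A) ∣ ≡ # A
∣tabulate∣ {zero}  A = refl
∣tabulate∣ {suc n} A with does (mem? A zero)
... | true  = cong suc (∣tabulate∣ (tail A))
... | false = ∣tabulate∣ (tail A)

∈-tabulate⁻ : (A : FinSet n) {v : Fin n} → v Sub.∈ tabulate (does ∘ mem? A) → v ∈ A
∈-tabulate⁻ A {v} v∈ with mem? A v | trans (sym (lookup∘tabulate (does ∘ mem? A) v)) ([]=⇒lookup v∈)
... | yes v∈A | _ = v∈A

∅ : FinSet n
∅ = ⟦ (λ _ → no (λ (x : ⊥) → x)) ⟧

subset : (A : FinSet n) (m : ℕ) → m ≤ # A → ∃[ M ] M ⊆ A × # M ≡ m
subset {n} A m m≤ with between ∅ A m (λ ()) (≤-trans (≤-reflexive (#-∅ {n} {∅} λ ())) z≤n) m≤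
... | M , _ , M⊆A , #M = M , M⊆A , #M

-- Numbering a set and its complement; complete bipartite graphs

record Separation (A : FinSet n) (p q : ℕ) : Set where
  field
    to      : Fin n → Fin p ⊎ Fin q
    from    : Fin p ⊎ Fin q → Fin n
    to-from : ∀ i → to (from i) ≡ i
    from-to : ∀ v → from (to v) ≡ v
    to-∈    : ∀ {v} → v ∈ A → ∃[ i ] to v ≡ inj₁ i
    to-∉    : ∀ {v} → ¬ v ∈ A → ∃[ j ] to v ≡ inj₂ j

insertˡ : ∀ {p q} → (Fin p ⊎ Fin q → Fin n) → Fin (suc p) ⊎ Fin q → Fin (suc n)
insertˡ f (inj₁ zero)    = zero
insertˡ f (inj₁ (suc i)) = suc (f (inj₁ i))
insertˡ f (inj₂ j)       = suc (f (inj₂ j))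

insertʳ : ∀ {p q} → (Fin p ⊎ Fin q → Fin n) → Fin p ⊎ Fin (suc q) → Fin (suc n)
insertʳ f (inj₁ i)       = suc (f (inj₁ i))
insertʳ f (inj₂ zero)    = zero
insertʳ f (inj₂ (suc j)) = suc (f (inj₂ j))

insertˡ-suc : ∀ {p q} (f : Fin p ⊎ Fin q → Fin n) s → insertˡ f (Sum.map₁ suc s) ≡ suc (f s)
insertˡ-suc f (inj₁ _) = refl
insertˡ-suc f (inj₂ _) = refl

insertʳ-suc : ∀ {p q} (f : Fin p ⊎ Fin q → Fin n) s → insertʳ f (Sum.map₂ suc s) ≡ suc (f s)
insertʳ-suc f (inj₁ _) = refl
insertʳ-suc f (inj₂ _) = refl

separate : ∀ {n} (A : FinSet n) → Separation A (# A) (# (∁ A))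
separate {zero} A = record
  { to = λ () ; from = λ { (inj₁ ()) ; (inj₂ ()) } ; to-from = λ { (inj₁ ()) ; (inj₂ ()) }
  ; from-to = λ () ; to-∈ = λ { {()} } ; to-∉ = λ { {()} } }
separate {suc n} A with mem? A zero | separate (tail A)
... | yes z∈A | rec = record
  { to      = λ { zero → inj₁ zero ; (suc v) → Sum.map₁ suc (R.to v) }
  ; from    = insertˡ R.from
  ; to-from = λ { (inj₁ zero) → refl ; (inj₁ (suc i)) → cong (Sum.map₁ suc) (R.to-from (inj₁ i))
                ; (inj₂ j) → cong (Sum.map₁ suc) (R.to-from (inj₂ j)) }
  ; from-to = λ { zero → refl ; (suc v) → trans (insertˡ-suc R.from (R.to v)) (cong suc (R.from-to v)) }
  ; to-∈    = λ { {zero} _ → zero , refl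
                ; {suc v} v∈A → suc (proj₁ (R.to-∈ v∈A)) , cong (Sum.map₁ suc) (proj₂ (R.to-∈ v∈A)) }
  ; to-∉    = λ { {zero} z∉A → contradiction z∈A z∉A
                ; {suc v} v∉A → proj₁ (R.to-∉ v∉A) , cong (Sum.map₁ suc) (proj₂ (R.to-∉ v∉A)) } }
  where
  module R = Separation rec
... | no z∉A | rec = record
  { to      = λ { zero → inj₂ zero ; (suc v) → Sum.map₂ suc (R.to v) }
  ; from    = insertʳ R.from
  ; to-from = λ { (inj₂ zero) → refl ; (inj₂ (suc i)) → cong (Sum.map₂ suc) (R.to-from (inj₂ i))
                ; (inj₁ j) → cong (Sum.map₂ suc) (R.to-from (inj₁ j)) }
  ; from-to = λ { zero → refl ; (suc v) → trans (insertʳ-suc R.from (R.to v)) (cong suc (R.from-to v)) }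
  ; to-∉    = λ { {zero} _ → zero , refl
                ; {suc v} v∉A → suc (proj₁ (R.to-∉ v∉A)) , cong (Sum.map₂ suc) (proj₂ (R.to-∉ v∉A)) }
  ; to-∈    = λ { {zero} z∈A → contradiction z∈A z∉A
                ; {suc v} v∈A → proj₁ (R.to-∈ v∈A) , cong (Sum.map₂ suc) (proj₂ (R.to-∈ v∈A)) } }
  where
  module R = Separation rec

module _ (G : Graph n) (A : FinSet n)
         (join-A : ∀ {x y} → x ∈ A → ¬ y ∈ A → Adj G x y)
         (A-indep : ∀ {x y} → x ∈ A → Adj G x y → ¬ y ∈ A)
         (∁A-indep : ∀ {x y} → ¬ x ∈ A → Adj G x y → y ∈ A) where

  private
    module E = Separation (separate A)

  to-K : Fin n → Fin (# A + # (∁ A))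
  to-K v = join (# A) (# (∁ A)) (E.to v)

  opposite⁺ : ∀ x y → Adj G x y → OppositeSides (E.to x) (E.to y)
  opposite⁺ x y xy with mem? A x
  ... | yes x∈A rewrite proj₂ (E.to-∈ x∈A) | proj₂ (E.to-∉ (A-indep x∈A xy)) = tt
  ... | no  x∉A rewrite proj₂ (E.to-∉ x∉A) | proj₂ (E.to-∈ (∁A-indep x∉A xy)) = tt

  opposite⁻ : ∀ x y → OppositeSides (E.to x) (E.to y) → Adj G x y
  opposite⁻ x y opp with mem? A x | mem? A y
  ... | yes x∈A | no y∉A  = join-A x∈A y∉A
  ... | no x∉A  | yes y∈A = adj-sym G (join-A y∈A x∉A)
  ... | yes x∈A | yes y∈A rewrite proj₂ (E.to-∈ x∈A) | proj₂ (E.to-∈ y∈A) with () ← opp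
  ... | no x∉A  | no y∉A  rewrite proj₂ (E.to-∉ x∉A) | proj₂ (E.to-∉ y∉A) with () ← opp

  complete-bipartite : G ≅ K (# A) (# (∁ A))
  complete-bipartite = record
    { bijection = mk↔ₛ′ to-K (E.from ∘ splitAt (# A))
        (λ i → trans (cong (join (# A) (# (∁ A))) (E.to-from (splitAt (# A) i)))
                     (Inverse.strictlyInverseʳ (+↔⊎ {# A} {# (∁ A)}) i))
        (λ v → trans (cong E.from (splitAt-join (# A) (# (∁ A)) (E.to v))) (E.from-to v))
    ; preserves = λ x y → mk⇔
        (λ xy → subst₂ OppositeSides (sym (sides x)) (sym (sides y)) (opposite⁺ x y xy))
        (λ opp → opposite⁻ x y (subst₂ OppositeSides (sides x) (sides y) opp))
    }
    where
    sides : ∀ v → splitAt (# A) (to-K v) ≡ E.to v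
    sides v = splitAt-join (# A) (# (∁ A)) (E.to v)

-- Cycles as lists of vertices

module Cycles (G : Graph n) where

  Chain : Fin n → List (Fin n) → Fin n → Set
  Chain u []       w = Adj G u w
  Chain u (v ∷ vs) w = Adj G u v × Chain v vs w

  -- An edge traversed back and forth also qualifies, hence the bound in `toCycle`.
  IsCycle : List (Fin n) → Set
  IsCycle []       = ⊥
  IsCycle (v ∷ vs) = Unique (v ∷ vs) × Chain v vs v

  HasCycle : ℕ → Set
  HasCycle m = ∃[ vs ] length vs ≡ m × IsCycle vs

  chain? : ∀ u vs w → Dec (Chain u vs w)
  chain? u []       w = adj? G u w
  chain? u (v ∷ vs) w = adj? G u v ×-dec chain? v vs w

  isCycle? : U.Decidable IsCycle
  isCycle? []       = no λ ()
  isCycle? (v ∷ vs) = unique? _≟_ (v ∷ vs) ×-dec chain? v vs v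

  -- Lists of a given length can be searched exhaustively, so the existence of a cycle of each
  -- length is decidable, and the induction on lengths can branch on it constructively.
  anyList? : ∀ m {P : List (Fin n) → Set} → U.Decidable P → Dec (∃[ vs ] length vs ≡ m × P vs)
  anyList? zero    P? = map′ (λ p → [] , refl , p) (λ { ([] , _ , p) → p }) (P? [])
  anyList? (suc m) P? = map′
    (λ (v , vs , len , p) → v ∷ vs , cong suc len , p)
    (λ { (v ∷ vs , len , p) → v , vs , suc-injective len , p })
    (any? λ v → anyList? m (P? ∘ (v ∷_)))

  hasCycle? : ∀ m → Dec (HasCycle m)
  hasCycle? m = anyList? m isCycle?

  lookup-injective : ∀ {vs : List (Fin n)} → Unique vs → Injective _≡_ _≡_ (lookup vs)
  lookup-injective {v ∷ vs} _ {zero} {zero} _ = refl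
  lookup-injective {v ∷ vs} (v∉ ∷ _) {zero} {suc j} eq = contradiction eq (All.lookup v∉ (∈-lookup j))
  lookup-injective {v ∷ vs} (v∉ ∷ _) {suc i} {zero} eq = contradiction (sym eq) (All.lookup v∉ (∈-lookup i))
  lookup-injective {v ∷ vs} (_ ∷ uniq) {suc i} {suc j} eq = cong suc (lookup-injective uniq eq)

  chain-step : ∀ {u w} vs → Chain u vs w → ∀ i j → toℕ j ≡ suc (toℕ i) →
               Adj G (lookup (u ∷ vs) i) (lookup (u ∷ vs) j)
  chain-step (v ∷ vs) (uv , _)  zero    (suc zero) _  = uv
  chain-step (v ∷ vs) (_ , vw)  (suc i) (suc j)    eq = chain-step vs vw i j (suc-injective eq)

  chain-last : ∀ {u w} vs → Chain u vs w → ∀ i → suc (toℕ i) ≡ length (u ∷ vs) →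
               Adj G (lookup (u ∷ vs) i) w
  chain-last []       uw       zero    _  = uw
  chain-last (v ∷ vs) (_ , vw) (suc i) eq = chain-last vs vw i (suc-injective eq)

  toCycle : ∀ {m} → 3 ≤ m → HasCycle m → Cycle G m
  toCycle 3≤m (v ∷ vs , refl , uniq , chain) = record
    { 3≤ℓ         = 3≤m
    ; vertex      = lookup (v ∷ vs)
    ; injective   = lookup-injective uniq
    ; consecutive = chain-step vs chain
    ; closing     = λ { i zero eq _ → chain-last vs chain i eq }
    }

-- Joined graphs

module Joined (G : Graph n) (a b : ℕ) (0<a : 0 < a) (a≤b : a ≤ b)
              (all-joined : AllPairsJoined G a b)
              (large-degree : ∀ v → a + b ≤ suc (degree G v)) where

  open Cycles G

  N : Fin n → FinSet n
  N v = ⟦ adj? G v ⟧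

  a+b≤1+#N : ∀ v → a + b ≤ suc (# (N v))
  a+b≤1+#N v = ≤-trans (large-degree v) (≤-reflexive (cong suc (∣tabulate∣ (N v))))

  -- The form in which the joining hypothesis is used throughout. `A` and `B` may overlap: at least
  -- `b` elements of `B` remain outside `A`, and any `b` of them are joined to `A`. Each later
  -- contradiction amounts to a lower bound `a + b` for a union.
  no-gap : (A B : FinSet n) → # A ≡ a → a + b ≤ # (A ∪ B) →
           ¬ (∀ {x y} → x ∈ A → y ∈ B → ¬ Adj G x y)
  no-gap A B #A a+b≤ gap with subset (B ∖ A) b b≤
    where
    open ≤-Reasoning
    cover : ∀ {v} → v ∈ A ∪ B → v ∈ A ⊎ v ∈ B ∖ A
    cover (inj₁ v∈A) = inj₁ v∈A
    cover {v} (inj₂ v∈B) with mem? A v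
    ... | yes v∈A = inj₁ v∈A
    ... | no  v∉A = inj₂ (v∈B , v∉A)
    b≤ : b ≤ # (B ∖ A)
    b≤ = +-cancelˡ-≤ a b (# (B ∖ A)) (begin
      a + b              ≤⟨ a+b≤ ⟩
      # (A ∪ B)          ≤⟨ #-subadditive {A = A ∪ B} {A} {B ∖ A} cover ⟩
      # A + # (B ∖ A)    ≡⟨ cong (_+ # (B ∖ A)) #A ⟩
      a + # (B ∖ A)      ∎)
  ... | B' , B'⊆ , #B'
    with all-joined (tabulate (does ∘ mem? A)) (tabulate (does ∘ mem? B'))
           (λ (v , v∈) → let v∈A , v∈B' = x∈p∩q⁻ _ _ v∈
                         in proj₂ (B'⊆ (∈-tabulate⁻ B' v∈B')) (∈-tabulate⁻ A v∈A))
           (trans (∣tabulate∣ A) #A) (trans (∣tabulate∣ B') #B')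
  ...   | x , y , x∈ , y∈ , xy = gap (∈-tabulate⁻ A x∈) (proj₁ (B'⊆ (∈-tabulate⁻ B' y∈))) xy

  Independent : FinSet n → Set
  Independent I = ∀ {x y} → x ∈ I → y ∈ I → ¬ Adj G x y

  independent-small : (I : FinSet n) → Independent I → # I < a + b
  independent-small I ind = ≰⇒> λ a+b≤ → case-subset a+b≤ (subset I a (≤-trans (m≤m+n a b) a+b≤))
    where
    case-subset : a + b ≤ # I → ∃[ A ] A ⊆ I × # A ≡ a → ⊥
    case-subset a+b≤ (A , A⊆I , #A) =
      no-gap A I #A (≤-trans a+b≤ (#-mono {A = I} {A ∪ I} inj₂)) λ x∈A → ind (A⊆I x∈A)

  -- If `w` had `a` non-neighbours in `I`, these would have no edge to `I` together with `w`, a set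
  -- of at least `a + b` vertices. So fewer than `a` elements of `I` are not seen by `w`.
  many-neighbours : (I : FinSet n) → Independent I → a + b ≤ suc (# I) →
                    ∀ {w} → ¬ w ∈ I → b ≤ # (I ∩ N w)
  many-neighbours I ind large {w} w∉I = +-cancelˡ-≤ a b _ (begin
    a + b                              ≤⟨ large ⟩
    suc (# I)                          ≤⟨ s≤s (#-subadditive {A = I} {I ∖ N w} {I ∩ N w} cover) ⟩
    suc (# (I ∖ N w)) + # (I ∩ N w)    ≤⟨ +-monoˡ-≤ (# (I ∩ N w)) few ⟩
    a + # (I ∩ N w)                    ∎)
    where
    open ≤-Reasoning
    cover : ∀ {v} → v ∈ I → v ∈ I ∖ N w ⊎ v ∈ I ∩ N w
    cover {v} v∈I with adj? G w v
    ... | yes wv = inj₂ (v∈I , wv)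
    ... | no ¬wv = inj₁ (v∈I , ¬wv)
    few : # (I ∖ N w) < a
    few = ≰⇒> λ a≤ → case-subset (subset (I ∖ N w) a a≤)
      where
      case-subset : ∃[ A ] A ⊆ I ∖ N w × # A ≡ a → ⊥
      case-subset (A , A⊆ , #A) = no-gap A (｛ w ｝ ∪ I) #A
        (begin
          a + b                    ≤⟨ large ⟩
          1 + # I                  ≡⟨ cong (_+ # I) (#-｛｝ w) ⟨
          # ｛ w ｝ + # I          ≤⟨ #-∪ {A = ｛ w ｝} {I} (λ { refl → w∉I }) ⟩
          # (｛ w ｝ ∪ I)          ≤⟨ #-mono {A = ｛ w ｝ ∪ I} {A ∪ ｛ w ｝ ∪ I} inj₂ ⟩
          # (A ∪ ｛ w ｝ ∪ I)      ∎)
        λ { x∈A (inj₁ refl) xw → proj₂ (A⊆ x∈A) (adj-sym G xw)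
          ; x∈A (inj₂ y∈I) → ind (proj₁ (A⊆ x∈A)) y∈I }

  2≤a+b : 2 ≤ a + b
  2≤a+b = +-mono-≤ 0<a (≤-trans 0<a a≤b)

  neighbour : ∀ v → ∃[ w ] Adj G v w
  neighbour v = #-inhabited (N v) (≤-pred (≤-trans 2≤a+b (a+b≤1+#N v)))

  -- Both sides are independent, hence have at most `a + b - 1` vertices, while a neighbourhood lies
  -- in the opposite side and has at least that many. So the sides have equal size and every
  -- neighbourhood is the whole opposite side.
  bipartite : (A : FinSet n) → (∀ {x y} → x ∈ A → Adj G x y → ¬ y ∈ A) →
              (∀ {x y} → ¬ x ∈ A → Adj G x y → y ∈ A) → Fin n → IsBalancedCompleteBipartite G
  bipartite A A-indep ∁A-indep v = # A , size , iso
    where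
    A≢∅ : ∃ (_∈ A)
    A≢∅ with mem? A v
    ... | yes v∈A = v , v∈A
    ... | no  v∉A = proj₁ (neighbour v) , ∁A-indep v∉A (proj₂ (neighbour v))
    ∁A≢∅ : ∃ (_∈ ∁ A)
    ∁A≢∅ = let x , x∈A = A≢∅ ; y , xy = neighbour x in y , A-indep x∈A xy
    N⊆∁A : ∀ {x} → x ∈ A → N x ⊆ ∁ A
    N⊆∁A x∈A xy = A-indep x∈A xy
    N⊆A : ∀ {x} → ¬ x ∈ A → N x ⊆ A
    N⊆A x∉A xy = ∁A-indep x∉A xy
    #A< : # A < a + b
    #A< = independent-small A λ x∈A y∈A xy → A-indep x∈A xy y∈A
    #∁A< : # (∁ A) < a + b
    #∁A< = independent-small (∁ A) λ x∉A y∉A xy → y∉A (∁A-indep x∉A xy)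
    #A≡#∁A : # A ≡ # (∁ A)
    #A≡#∁A = let x , x∈A = A≢∅ ; y , y∉A = ∁A≢∅ in ≤-antisym
      (≤-pred (≤-trans #A< (≤-trans (a+b≤1+#N x) (s≤s (#-mono {A = N x} {∁ A} (N⊆∁A x∈A))))))
      (≤-pred (≤-trans #∁A< (≤-trans (a+b≤1+#N y) (s≤s (#-mono {A = N y} {A} (N⊆A y∉A))))))
    size : n ≡ 2 * # A
    size = trans (sym (#-∁ A)) (cong (# A +_) (trans (sym #A≡#∁A) (sym (+-identityʳ (# A)))))
    join-A : ∀ {x y} → x ∈ A → ¬ y ∈ A → Adj G x y
    join-A {x} {y} x∈A y∉A = ⊆-by-size (N x) (∁ A) (N⊆∁A x∈A)
      (≤-pred (≤-trans #∁A< (a+b≤1+#N x))) y∉A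
    iso : G ≅ K (# A) (# A)
    iso = subst (λ k → G ≅ K (# A) k) (sym #A≡#∁A) (complete-bipartite G A join-A A-indep ∁A-indep)

  triangle : ∀ {x y z} → Adj G x y → Adj G y z → Adj G z x → HasCycle 3
  triangle {x} {y} {z} xy yz zx = x ∷ y ∷ z ∷ [] , refl ,
    ((distinct xy ∷ (distinct zx ∘ sym) ∷ []) ∷ (distinct yz ∷ []) ∷ [] ∷ []) , xy , yz , zx
    where
    distinct : ∀ {u v} → Adj G u v → u ≢ v
    distinct uv u≡v = adj-irrefl G u≡v uv

  triangle-free : ¬ HasCycle 3 → Fin n → IsBalancedCompleteBipartite G
  triangle-free no-triangle v = bipartite (N v)
    (λ {x} {y} vx xy vy → N-independent vx vy xy)
    (λ {x} {y} x∉ xy → decidable-stable (adj? G v y) λ y∉ → outside-independent x∉ y∉ xy) v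
    where
    N-independent : Independent (N v)
    N-independent vx vy xy = no-triangle (triangle vx xy (adj-sym G vy))

    -- b + b exceeds the size of the independent set N v, so x and y share a neighbour in it.
    outside-independent : ∀ {x y} → ¬ x ∈ N v → ¬ y ∈ N v → ¬ Adj G x y
    outside-independent {x} {y} x∉ y∉ xy =
      <⇒≱ (independent-small (N v) N-independent) (begin
        a + b                                ≤⟨ +-monoˡ-≤ b a≤b ⟩
        b + b                                ≤⟨ +-mono-≤ (many x∉) (many y∉) ⟩
        # (N v ∩ N x) + # (N v ∩ N y)        ≤⟨ #-superadditive {A = N v ∩ N x} {N v ∩ N y} {N v}
                                                  (λ (_ , xz) (_ , yz) → no-triangle
                                                    (triangle xy yz (adj-sym G xz))) proj₁ proj₁ ⟩
        # (N v)                              ∎)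
      where
      open ≤-Reasoning
      many : ∀ {w} → ¬ w ∈ N v → b ≤ # (N v ∩ N w)
      many = many-neighbours (N v) N-independent (a+b≤1+#N v)

-- A cycle of length 3 + l, unrolled to a periodic sequence of vertices.
record Circuit (G : Graph n) (l : ℕ) : Set where
  field
    c         : ℕ → Fin n
    period    : ∀ i → c (3 + l + i) ≡ c i
    injective : ∀ {i j} → i < 3 + l → j < 3 + l → c i ≡ c j → i ≡ j
    step      : ∀ i → Adj G (c i) (c (suc i))

circuit : ∀ {G : Graph n} {l} → Cycle G (3 + l) → Circuit G l
circuit {G = G} {l} cycle = record
  { c         = c
  ; period    = λ i → cong vertex (toℕ-injective (trans (toℕ-mod (3 + l + i))
                  (trans (trans (cong (_% (3 + l)) (+-comm (3 + l) i)) ([m+n]%n≡m%n i (3 + l)))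
                         (sym (toℕ-mod i)))))
  ; injective = λ {i} {j} i< j< eq → trans (sym (m<n⇒m%n≡m i<)) (trans
                  (trans (sym (toℕ-mod i)) (trans (cong toℕ (vertex-injective eq)) (toℕ-mod j)))
                  (m<n⇒m%n≡m j<))
  ; step      = step
  }
  where
  open Cycle cycle renaming (injective to vertex-injective)
  c : ℕ → Fin _
  c i = vertex (i mod (3 + l))
  toℕ-mod : ∀ i → toℕ (i mod (3 + l)) ≡ i % (3 + l)
  toℕ-mod i = toℕ-fromℕ< (m%n<n i (3 + l))
  suc-% : ∀ i → suc i % (3 + l) ≡ suc (i % (3 + l)) % (3 + l)
  suc-% i = trans (cong (λ j → suc j % (3 + l)) (m≡m%n+[m/n]*n i (3 + l)))
                  ([m+kn]%n≡m%n (suc (i % (3 + l))) (i / (3 + l)) (3 + l))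
  step : ∀ i → Adj G (c i) (c (suc i))
  step i with m≤n⇒m<n∨m≡n (m%n<n i (3 + l))
  ... | inj₁ inside = consecutive (i mod (3 + l)) (suc i mod (3 + l))
    (trans (toℕ-mod (suc i)) (trans (suc-% i) (trans (m<n⇒m%n≡m inside) (cong suc (sym (toℕ-mod i))))))
  ... | inj₂ last = closing (i mod (3 + l)) (suc i mod (3 + l))
    (trans (cong suc (toℕ-mod i)) last)
    (trans (toℕ-mod (suc i)) (trans (suc-% i) (trans (cong (_% (3 + l)) last) (n%n≡0 (3 + l)))))

-- Positions and segments on a cycle

module Surgery {G : Graph n} {l : ℕ} (K : Circuit G l) where

  open Cycles G
  open Circuit K

  multiple : ∀ q i → c (q * (3 + l) + i) ≡ c i
  multiple zero    i = refl
  multiple (suc q) i = trans (cong c (+-assoc (3 + l) (q * (3 + l)) i))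
                             (trans (period (q * (3 + l) + i)) (multiple q i))

  c-% : ∀ d i → c (d + i) ≡ c (d + i % (3 + l))
  c-% d i = trans (cong c eq) (multiple (i / (3 + l)) (d + i % (3 + l)))
    where
    eq : d + i ≡ i / (3 + l) * (3 + l) + (d + i % (3 + l))
    eq = trans (cong (d +_) (m≡m%n+[m/n]*n i (3 + l)))
           (solve 3 (λ d r m → d :+ (r :+ m) := m :+ (d :+ r)) refl
             d (i % (3 + l)) (i / (3 + l) * (3 + l)))

  -- Positions of the same vertex are congruent modulo the length, so they can be advanced together.
  -- A step back is an advance by `2 + l`.
  shift : ∀ d {i j} → c i ≡ c j → c (d + i) ≡ c (d + j)
  shift d {i} {j} ci≡cj = trans (c-% d i) (trans (cong (λ r → c (d + r)) same) (sym (c-% d j)))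
    where
    same : i % (3 + l) ≡ j % (3 + l)
    same = injective (m%n<n i (3 + l)) (m%n<n j (3 + l))
             (trans (sym (c-% 0 i)) (trans ci≡cj (c-% 0 j)))

  window-injective : ∀ p {i j} → i < 3 + l → j < 3 + l → c (i + p) ≡ c (j + p) → i ≡ j
  window-injective p {i} {j} i< j< eq =
    injective i< j< (trans (sym (back i)) (trans (shift (p * (2 + l)) eq) (back j)))
    where
    -- Advancing by `p * (2 + l)` undoes the shift by `p`: together they make `p` full turns.
    back : ∀ i → c (p * (2 + l) + (i + p)) ≡ c i
    back i = trans (cong c (solve 3 (λ p i l → p :* (con 2 :+ l) :+ (i :+ p) := p :* (con 3 :+ l) :+ i)
                              refl p i l))
                   (multiple p i)

  C : FinSet n
  C = ⟦ (λ v → anyUpTo? (λ j → c j ≟ v) (3 + l)) ⟧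

  c∈C : ∀ i → c i ∈ C
  c∈C i = i % (3 + l) , m%n<n i (3 + l) , sym (c-% 0 i)

  -- Both are the identity off the cycle. This makes them mutually inverse on all vertices, so that
  -- shifting a set along the cycle preserves its size.
  succ pred : Fin n → Fin n
  succ v with mem? C v
  ... | yes (j , _) = c (suc j)
  ... | no  _       = v
  pred v with mem? C v
  ... | yes (j , _) = c (2 + l + j)
  ... | no  _       = v

  succ-c : ∀ i → succ (c i) ≡ c (suc i)
  succ-c i with mem? C (c i)
  ... | yes (j , _ , eq) = shift 1 eq
  ... | no  ci∉C         = contradiction (c∈C i) ci∉C

  pred-c : ∀ i → pred (c (suc i)) ≡ c i
  pred-c i with mem? C (c (suc i))
  ... | yes (j , _ , eq) = trans (shift (2 + l) eq) (trans (cong c (+-suc (2 + l) i)) (period i))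
  ... | no  c∉C          = contradiction (c∈C (suc i)) c∉C

  -- Every vertex of the cycle occurs beyond position 0, so it also has a position for its predecessor.
  position : ∀ {v} → v ∈ C → ∃[ i ] v ≡ c (suc i)
  position (j , _ , refl) = 2 + l + j , sym (period j)

  locate : ∀ {v} → v ∈ C → ∀ i → ∃[ j ] j < 3 + l × v ≡ c (j + i)
  locate (m , _ , refl) i = j , m%n<n r (3 + l) , sym (begin
    c (j + i)                  ≡⟨ cong c (+-comm j i) ⟩
    c (i + j)                  ≡⟨ c-% i r ⟨
    c (i + r)                  ≡⟨ cong c (solve 3 (λ i m l → i :+ (m :+ i :* (con 2 :+ l))
                                                   := i :* (con 3 :+ l) :+ m) refl i m l) ⟩
    c (i * (3 + l) + m)        ≡⟨ multiple i m ⟩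
    c m                        ∎)
    where
    open ≡-Reasoning
    -- Congruent to `m - i` modulo the length, without subtraction.
    r = m + i * (2 + l)
    j = r % (3 + l)

  succ∈C : ∀ {v} → v ∈ C → succ v ∈ C
  succ∈C v∈C with position v∈C
  ... | i , refl = subst (_∈ C) (sym (succ-c (suc i))) (c∈C (2 + i))

  pred∈C : ∀ {v} → v ∈ C → pred v ∈ C
  pred∈C v∈C with position v∈C
  ... | i , refl = subst (_∈ C) (sym (pred-c i)) (c∈C i)

  succ-pred : ∀ v → succ (pred v) ≡ v
  succ-pred v with mem? C v in eq
  ... | no v∉C rewrite eq = refl
  ... | yes (j , _ , refl) = trans (succ-c (2 + l + j)) (period j)

  pred-succ : ∀ v → pred (succ v) ≡ v
  pred-succ v with mem? C v in eq
  ... | no v∉C rewrite eq = refl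
  ... | yes (j , _ , refl) = pred-c j

  up down : ℕ → ℕ → List (Fin n)
  up p zero      = []
  up p (suc m)   = c p ∷ up (suc p) m
  down p zero    = []
  down p (suc m) = c (m + p) ∷ down p m

  up-chain : ∀ m p {x y vs} → Adj G x (c p) → Chain (c (m + p)) vs y →
             Chain x (up p (suc m) ++ vs) y
  up-chain zero    p xp py = xp , py
  up-chain (suc m) p {y = y} {vs} xp py = xp ,
    up-chain m (suc p) (step p) (subst (λ i → Chain (c i) vs y) (sym (+-suc m p)) py)

  down-chain : ∀ m p {x y vs} → Adj G x (c (m + p)) → Chain (c p) vs y →
               Chain x (down p (suc m) ++ vs) y
  down-chain zero    p xp py = xp , py
  down-chain (suc m) p xp py = xp , down-chain m p (adj-sym G (step (m + p))) py

  -- The direction of traversal is forgotten: distinctness in a new cycle depends only on which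
  -- window of positions a segment occupies.
  record Block (p m : ℕ) (vs : List (Fin n)) : Set where
    field
      unique : Unique vs
      range  : All (λ v → ∃[ i ] i < m × v ≡ c (i + p)) vs
      size   : length vs ≡ m

  open Block

  up-block : ∀ {m} p → m ≤ 3 + l → Block p m (up p m)
  up-block {zero}  p _  = record { unique = [] ; range = [] ; size = refl }
  up-block {suc m} p m< = record
    { unique = All.map (λ { (i , i< , refl) eq → fresh i i< eq }) (range rest) ∷ unique rest
    ; range  = (0 , s≤s z≤n , refl) ∷
               All.map (λ { (i , i< , refl) → suc i , s≤s i< , cong c (+-suc i p) }) (range rest)
    ; size   = cong suc (size rest)
    }
    where
    rest = up-block {m} (suc p) (<⇒≤ m<)
    fresh : ∀ i → i < m → c p ≢ c (i + suc p)
    fresh i i< eq with () ← window-injective p {0} {suc i} (s≤s z≤n) (≤-trans (s≤s i<) m<)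
                             (trans eq (cong c (+-suc i p)))

  down-block : ∀ {m} p → m ≤ 3 + l → Block p m (down p m)
  down-block {zero}  p _  = record { unique = [] ; range = [] ; size = refl }
  down-block {suc m} p m< = record
    { unique = All.map (λ { (i , i< , refl) eq → <⇒≢ i< (sym (window-injective p m< (<-trans i< m<) eq)) })
                       (range rest) ∷ unique rest
    ; range  = (m , ≤-refl , refl) ∷ All.map (λ { (i , i< , eq) → i , m<n⇒m<1+n i< , eq }) (range rest)
    ; size   = cong suc (size rest)
    }
    where
    rest = down-block {m} p (<⇒≤ m<)

  record Inner (m : ℕ) (vs : List (Fin n)) : Set where
    field
      inner-unique : Unique vs
      inner-∈C     : All (_∈ C) vs
      inner-size   : length vs ≡ m

  open Inner

  -- `g` counts the vertices skipped between the segments. Segments and gap fit into one turn, so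
  -- `window-injective` keeps the segments disjoint. The final `[]` matches the lists built by
  -- `up-chain` and `down-chain`.
  two-blocks : ∀ g {p m m′ us vs} → Block p m us → Block (g + (m + p)) m′ vs → m + (g + m′) ≤ 3 + l →
               Inner (m + m′) (us ++ vs ++ [])
  two-blocks g {p} {m} {m′} {us} {vs} bu bv fits = record
    { inner-unique = Uniqueₚ.++⁺ (unique bu) (Uniqueₚ.++⁺ (unique bv) [] λ { (_ , ()) }) disjoint
    ; inner-∈C     = Allₚ.++⁺ (All.map ∈C (range bu)) (Allₚ.++⁺ (All.map ∈C (range bv)) [])
    ; inner-size   = trans (length-++ us) (cong₂ _+_ (size bu)
                       (trans (length-++ vs) (trans (+-identityʳ (length vs)) (size bv))))
    }
    where
    ∈C : ∀ {p m v} → ∃[ i ] i < m × v ≡ c (i + p) → v ∈ C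
    ∈C (i , _ , refl) = c∈C _
    apart : ∀ {v} → ∃[ i ] i < m × v ≡ c (i + p) → ¬ (∃[ j ] j < m′ × v ≡ c (j + (g + (m + p))))
    apart (i , i< , refl) (j , j< , eq) = <⇒≢ (≤-trans i< (≤-trans (m≤m+n m g) (m≤n+m (m + g) j)))
      (window-injective p
        (≤-trans i< (≤-trans (m≤m+n m (g + m′)) fits))
        (≤-trans (≤-trans (s≤s (≤-reflexive (solve 3 (λ j m g → j :+ (m :+ g) := m :+ (g :+ j)) refl j m g)))
           (≤-trans (≤-reflexive (sym (trans (cong (m +_) (+-suc g j)) (+-suc m (g + j)))))
             (+-monoʳ-≤ m (+-monoʳ-≤ g j<)))) fits)
        (trans eq (cong c (solve 4 (λ j g m p → j :+ (g :+ (m :+ p)) := (j :+ (m :+ g)) :+ p) refl j g m p))))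
    disjoint : ∀ {v} → v ∈ₗ us × v ∈ₗ (vs ++ []) → ⊥
    disjoint {v} (v∈us , v∈rest) = apart {v} (All.lookup (range bu) v∈us)
      (All.lookup (Allₚ.++⁺ (range bv) []) v∈rest)

  -- The common shape of all the longer cycles below: a path off `C` followed by one or two segments
  -- of `C`, with one vertex more than `C` in total.
  close : ∀ {x xs vs m} → Unique (x ∷ xs) → All (λ v → ¬ v ∈ C) (x ∷ xs) → Inner m vs →
          length (x ∷ xs) + m ≡ 4 + l → Chain x (xs ++ vs) x → HasCycle (4 + l)
  close {x} {xs} {vs} uniq outside inner size chain = (x ∷ xs) ++ vs
    , trans (length-++ (x ∷ xs)) (trans (cong (length (x ∷ xs) +_) (inner-size inner)) size)
    , Uniqueₚ.++⁺ uniq (inner-unique inner)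
        (λ (v∈xs , v∈vs) → All.lookup outside v∈xs (All.lookup (inner-∈C inner) v∈vs))
    , chain

  infix 4 _~_
  _~_ : Fin n → Fin n → Set
  _~_ = Adj G

  ~⇒≢ : ∀ {x y} → x ~ y → x ≢ y
  ~⇒≢ xy x≡y = adj-irrefl G x≡y xy

  ~-sym : ∀ {x y} → x ~ y → y ~ x
  ~-sym = adj-sym G

  private
    at : ∀ {x i j} → i ≡ j → x ~ c i → x ~ c j
    at {x} i≡j = subst (λ i → x ~ c i) i≡j

    from-start : ∀ {x i j} → c i ≡ c j → x ~ c j → c i ~ x
    from-start {x} eq xj = ~-sym (subst (x ~_) (sym eq) xj)

    wrap : ∀ {i j} → i ≡ 3 + l + j → c i ≡ c j
    wrap {j = j} i≡ = trans (cong c i≡) (period j)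

    single : ∀ {p m us} → Block p m us → m ≤ 3 + l → Inner (m + 0) (us ++ [] ++ [])
    single {p} {m} bu m≤ = two-blocks 0 {p} {m} {0} bu (up-block (m + p) z≤n)
      (≤-trans (≤-reflexive (+-identityʳ m)) m≤)

  -- Lengthening the cycle by one

  insertion : ∀ {x v} → ¬ x ∈ C → v ∈ C → x ~ v → x ~ succ v → HasCycle (4 + l)
  insertion {x} x∉ v∈ xv xsv with position v∈
  ... | i , refl = close ([] ∷ []) (x∉ ∷ []) (single (up-block (2 + i) ≤-refl) ≤-refl)
    (cong (4 +_) (+-identityʳ l))
    (up-chain (2 + l) (2 + i) (subst (x ~_) (succ-c (suc i)) xsv)
      (from-start (wrap (cong (2 +_) (solve 2 (λ l i → l :+ (con 2 :+ i) := con 1 :+ (l :+ (con 1 :+ i)))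
                                       refl l i))) xv))

  -- The new cycle runs from `x` to `w`, back to v⁺, across to w⁺ and on to `v`, keeping all of `C`.
  crossing : ∀ {x v w} → ¬ x ∈ C → v ∈ C → w ∈ C → v ≢ w → x ~ v → x ~ w →
             succ v ~ succ w → HasCycle (4 + l)
  crossing {x} x∉ v∈ w∈ v≢w xv xw svsw with position v∈
  ... | i₀ , refl with locate w∈ (suc i₀)
  ...   | zero  , _ , refl = contradiction refl v≢w
  ...   | suc j , s≤s j< , refl with m≤n⇒∃[o]m+o≡n j<
  ...     | e , size = close ([] ∷ []) (x∉ ∷ [])
    (two-blocks 0 (down-block (suc i) (m≤n⇒m≤1+n j<)) (up-block (suc j + suc i) e≤)
      (≤-reflexive fits))
    (cong suc fits)
    (down-chain j (suc i) (at (sym (+-suc j i)) xw)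
      (up-chain e (suc j + suc i)
        (subst₂ _~_ (succ-c i) (trans (succ-c (suc j + i)) (cong c (cong suc (sym (+-suc j i))))) svsw)
        (from-start (wrap (trans (solve 3 (λ e j i → e :+ (con 1 :+ j :+ (con 1 :+ i)) := con 1 :+ (con 1 :+ j :+ e :+ i))
                                    refl e j i) (cong (λ k → suc (k + i)) size))) xv)))
    where
    i = suc i₀
    fits : suc j + suc e ≡ 3 + l
    fits = trans (+-suc (suc j) e) (cong suc size)
    e≤ : suc e ≤ 3 + l
    e≤ = ≤-trans (m≤n+m (suc e) (suc j)) (≤-reflexive fits)

  -- The new cycle runs from `y` to z⁺, on to `q`, along the chord to `z` and back to q⁺.
  rotation : ∀ {y z q} → ¬ y ∈ C → z ∈ C → q ∈ C → z ~ q → y ~ succ z → y ~ succ q →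
             HasCycle (4 + l)
  rotation {y} y∉ z∈ q∈ zq ysz ysq with position z∈
  ... | i₀ , refl with locate q∈ (suc i₀)
  ...   | zero  , _ , refl = contradiction refl (~⇒≢ zq)
  ...   | suc j , s≤s j< , refl with m≤n⇒∃[o]m+o≡n j<
  ...     | e , size = close ([] ∷ []) (y∉ ∷ [])
    (two-blocks 0 (up-block (suc i) (m≤n⇒m≤1+n j<)) (down-block (suc j + suc i) e≤)
      (≤-reflexive fits))
    (cong suc fits)
    (up-chain j (suc i) (subst (y ~_) (succ-c i) ysz)
      (down-chain e (suc j + suc i)
        (subst₂ _~_ (cong c (sym (+-suc j i)))
          (sym (wrap (trans (solve 3 (λ e j i → e :+ (con 1 :+ j :+ (con 1 :+ i)) := con 1 :+ (con 1 :+ j :+ e :+ i))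
                                    refl e j i) (cong (λ k → suc (k + i)) size))))
          (~-sym zq))
        (~-sym (subst (y ~_) (trans (succ-c (suc j + i)) (cong c (cong suc (sym (+-suc j i))))) ysq))))
    where
    i = suc i₀
    fits : suc j + suc e ≡ 3 + l
    fits = trans (+-suc (suc j) e) (cong suc size)
    e≤ : suc e ≤ 3 + l
    e≤ = ≤-trans (m≤n+m (suc e) (suc j)) (≤-reflexive fits)

  -- The path `w`, `y` replaces `z`.
  detour₂ : ∀ {y w z} → ¬ y ∈ C → ¬ w ∈ C → z ∈ C → y ~ succ z → w ~ pred z → y ~ w →
            HasCycle (4 + l)
  detour₂ {y} {w} y∉ w∉ z∈ ysz wpz yw with position z∈
  ... | i , refl = close {w} {y ∷ []} ((~⇒≢ (~-sym yw) ∷ []) ∷ [] ∷ []) (w∉ ∷ y∉ ∷ [])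
    (single (up-block (2 + i) (n≤1+n (2 + l))) (n≤1+n (2 + l)))
    (cong (4 +_) (+-identityʳ l))
    (~-sym yw , up-chain (suc l) (2 + i) (subst (y ~_) (succ-c (suc i)) ysz)
      (from-start (wrap (solve 2 (λ l i → con 1 :+ l :+ (con 2 :+ i) := con 3 :+ l :+ i) refl l i))
        (subst (w ~_) (pred-c i) wpz)))

  -- As in `rotation`, with two vertices inserted and q⁺ dropped: `u`, `x`, z⁺ on to `q`, then `z`
  -- back to q⁺⁺. For `q` equal to z⁻ the dropped vertex would be `z` and the second segment empty.
  rotation₂ : ∀ {u x z q} → ¬ u ∈ C → ¬ x ∈ C → z ∈ C → q ∈ C → u ~ x → x ~ succ z → z ~ q →
              q ≢ pred z → u ~ succ (succ q) → HasCycle (4 + l)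
  rotation₂ {u} {x} u∉ x∉ z∈ q∈ ux xsz zq q≢ ussq with position z∈
  ... | i₀ , refl with locate q∈ (suc i₀)
  ...   | zero  , _ , refl = contradiction refl (~⇒≢ zq)
  ...   | suc j , s≤s (s≤s j<) , refl with m≤n⇒∃[o]m+o≡n j<
  ...     | zero , size = contradiction (trans (wrap last) (sym (pred-c i₀))) q≢
    where
    last : suc j + suc i₀ ≡ 3 + l + i₀
    last = trans (+-suc (suc j) i₀)
             (cong (λ k → 2 + (k + i₀)) (trans (sym (+-identityʳ j)) size))
  ...     | suc e , size = close {u} {x ∷ []} ((~⇒≢ ux ∷ []) ∷ [] ∷ []) (u∉ ∷ x∉ ∷ [])
    (two-blocks 1 (up-block (suc i) (≤-trans (m≤m+n (suc j) (1 + suc e)) (≤-reflexive fits)))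
                  (down-block (1 + (suc j + suc i)) (≤-trans (m≤n+m (suc e) (suc (suc j))) (≤-reflexive
                    (trans (sym (+-suc (suc j) (suc e))) fits))))
                  (≤-reflexive fits))
    (cong suc (trans (sym (+-suc (suc j) (suc e))) fits))
    (ux , up-chain j (suc i) (subst (x ~_) (succ-c i) xsz)
      (down-chain e (1 + (suc j + suc i))
        (subst₂ _~_ (cong c (sym (+-suc j i))) (sym (wrap start)) (~-sym zq))
        (~-sym (subst (u ~_) end ussq))))
    where
    i = suc i₀
    fits : suc j + (1 + suc e) ≡ 3 + l
    fits = trans (+-suc (suc j) (suc e)) (cong (2 +_) size)
    start : e + (1 + (suc j + suc i)) ≡ 3 + l + i
    start = trans (solve 3 (λ e j i → e :+ (con 1 :+ (con 1 :+ j :+ (con 1 :+ i)))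
                                      := con 2 :+ (j :+ (con 1 :+ e) :+ i)) refl e j i)
                  (cong (λ k → 2 + (k + i)) size)
    end : succ (succ (c (suc j + i))) ≡ c (1 + (suc j + suc i))
    end = trans (cong succ (succ-c (suc j + i))) (trans (succ-c (suc (suc j + i)))
            (cong (c ∘ suc) (sym (+-suc (suc j) i))))

  -- The two vertices between q and z are dropped, and y, u, x are inserted after z.
  handle : ∀ {x u y z q} → ¬ x ∈ C → ¬ u ∈ C → ¬ y ∈ C → z ∈ C → q ∈ C →
           succ (succ (succ q)) ≡ z → z ~ q → y ~ z → y ~ u → u ~ x → y ≢ x → x ~ succ z →
           HasCycle (4 + l)
  handle {x} {u} {y} {z} {q} x∉ u∉ y∉ z∈ q∈ sssq zq yz yu ux y≢x xsz with position z∈ | position q∈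
  ... | i₀ , refl | k , refl = build l refl
    where
    i = suc i₀
    q≡ : c (suc k) ≡ c (l + i)
    q≡ = trans (sym (period (suc k))) (trans
      (cong c (solve 2 (λ l k → con 3 :+ l :+ (con 1 :+ k) := l :+ (con 4 :+ k)) refl l k))
      (shift l (trans (sym (trans (cong (succ ∘ succ) (succ-c (suc k)))
                              (trans (cong succ (succ-c (2 + k))) (succ-c (3 + k))))) sssq)))
    -- `q` lies `l` positions after `z`, so `l = 0` would make the chord a loop. Otherwise the first
    -- segment has `l` vertices, from z⁺ to `q`, and the second is `z` alone.
    build : ∀ l′ → l′ ≡ l → HasCycle (4 + l)
    build zero     0≡l = contradiction (trans (cong (λ m → c (m + i)) 0≡l) (sym q≡)) (~⇒≢ zq)
    build (suc l′) eq = close {y} {u ∷ x ∷ []}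
      ((~⇒≢ yu ∷ y≢x ∷ []) ∷ (~⇒≢ ux ∷ []) ∷ [] ∷ []) (y∉ ∷ u∉ ∷ x∉ ∷ [])
      (two-blocks 2 (up-block (suc i) (≤-trans (≤-reflexive eq) (m≤n+m l 3)))
                    (down-block {1} (2 + (suc l′ + suc i)) (s≤s z≤n))
                    (≤-reflexive (trans (+-comm (suc l′) 3) (cong (3 +_) eq))))
      (cong (3 +_) (trans (+-comm (suc l′) 1) (cong suc eq)))
      (yu , ux , up-chain l′ (suc i) (subst (x ~_) (succ-c i) xsz)
        (down-chain 0 (2 + (suc l′ + suc i))
          (subst₂ _~_ (trans q≡ (cong c (trans (cong (_+ i) (sym eq)) (sym (+-suc l′ i)))))
                      (sym z≡) (~-sym zq))
          (from-start z≡ yz)))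
      where
      z≡ : c (2 + (suc l′ + suc i)) ≡ c i
      z≡ = wrap (cong (2 +_) (trans (+-suc (suc l′) i) (cong (λ m → suc (m + i)) eq)))

  -- As in `crossing`, with two vertices inserted and v⁺ dropped: `x`, `u`, `w` back to v⁺⁺, then w⁺
  -- on to `v`.
  crossing₂ : ∀ {x u v w} → ¬ x ∈ C → ¬ u ∈ C → v ∈ C → w ∈ C → x ~ u → x ~ v → u ~ w →
              v ≢ w → w ≢ succ v → succ (succ v) ~ succ w → HasCycle (4 + l)
  crossing₂ {x} {u} x∉ u∉ v∈ w∈ xu xv uw v≢w w≢sv ssvsw with position v∈
  ... | i₀ , refl with locate w∈ (suc i₀)
  ...   | 0           , _ , refl = contradiction refl v≢w
  ...   | 1           , _ , refl = contradiction (sym (succ-c (suc i₀))) w≢sv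
  ...   | suc (suc j) , s≤s (s≤s (s≤s j≤)) , refl with m≤n⇒∃[o]m+o≡n j≤
  ...     | e , size = close {x} {u ∷ []} ((~⇒≢ xu ∷ []) ∷ [] ∷ []) (x∉ ∷ u∉ ∷ [])
    (two-blocks 0 (down-block (2 + i) (≤-trans (m≤m+n (suc j) (suc e)) (m≤n⇒m≤1+n (≤-reflexive fits))))
                  (up-block (suc j + (2 + i)) (≤-trans (m≤n+m (suc e) (suc j)) (m≤n⇒m≤1+n (≤-reflexive fits))))
                  (m≤n⇒m≤1+n (≤-reflexive fits)))
    (cong (2 +_) fits)
    (xu , down-chain j (2 + i) (at (solve 2 (λ j i → con 2 :+ j :+ i := j :+ (con 2 :+ i)) refl j i) uw)
      (up-chain e (suc j + (2 + i))
        (subst₂ _~_ (trans (cong succ (succ-c i)) (succ-c (suc i)))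
                    (trans (succ-c (2 + j + i)) (cong c (solve 2 (λ j i → con 3 :+ j :+ i
                        := con 1 :+ j :+ (con 2 :+ i)) refl j i))) ssvsw)
        (from-start (wrap (trans (solve 3 (λ e j i → e :+ (con 1 :+ j :+ (con 2 :+ i))
                                           := con 3 :+ (j :+ e :+ i)) refl e j i)
                                 (cong (λ k → 3 + (k + i)) size))) xv)))
    where
    i = suc i₀
    fits : suc j + suc e ≡ 2 + l
    fits = trans (+-suc (suc j) e) (cong (2 +_) size)

  -- The three vertices replace v⁺ and v⁺⁺.
  detour₃ : ∀ {e₁ e₂ e₃ v} → ¬ e₁ ∈ C → ¬ e₂ ∈ C → ¬ e₃ ∈ C → v ∈ C → e₁ ~ v → e₁ ~ e₂ →
            e₂ ~ e₃ → e₁ ≢ e₃ → e₃ ~ succ (succ (succ v)) → HasCycle (4 + l)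
  detour₃ {e₁} {e₂} {e₃} e₁∉ e₂∉ e₃∉ v∈ e₁v e₁e₂ e₂e₃ e₁≢e₃ e₃sssv with position v∈
  ... | i₀ , refl = close {e₁} {e₂ ∷ e₃ ∷ []}
    ((~⇒≢ e₁e₂ ∷ e₁≢e₃ ∷ []) ∷ (~⇒≢ e₂e₃ ∷ []) ∷ [] ∷ []) (e₁∉ ∷ e₂∉ ∷ e₃∉ ∷ [])
    (single (up-block (3 + i) (s≤s (m≤n+m l 2))) (s≤s (m≤n+m l 2)))
    (cong (4 +_) (+-identityʳ l))
    (e₁e₂ , e₂e₃ , up-chain l (3 + i)
      (subst (e₃ ~_) (trans (cong (succ ∘ succ) (succ-c i)) (trans (cong succ (succ-c (suc i))) (succ-c (2 + i)))) e₃sssv)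
      (from-start (wrap (solve 2 (λ l i → l :+ (con 3 :+ i) := con 3 :+ l :+ i) refl l i)) e₁v))
    where
    i = suc i₀

-- A cycle that has no cycle one longer

module Extension
  (G : Graph n) (a b : ℕ) (0<a : 0 < a) (a≤b : a ≤ b) (all-joined : AllPairsJoined G a b)
  (large-degree : ∀ v → a + b ≤ suc (degree G v))
  {l : ℕ} (K : Circuit G l) (no-longer : ¬ Cycles.HasCycle G (4 + l)) where

  open Cycles G
  open Joined G a b 0<a a≤b all-joined large-degree
  open Circuit K using (c)
  open Surgery K

  inn out : Fin n → FinSet n
  inn z = N z ∩ C
  out z = N z ∖ C

  degree-split : ∀ z → a + b ≤ suc (# (out z) + # (inn z))
  degree-split z = ≤-trans (a+b≤1+#N z) (s≤s (#-subadditive {A = N z} {out z} {inn z} split))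
    where
    split : ∀ {v} → v ∈ N z → v ∈ out z ⊎ v ∈ inn z
    split {v} zv with mem? C v
    ... | yes v∈C = inj₂ (zv , v∈C)
    ... | no  v∉C = inj₁ (zv , v∉C)

  few-out : ∀ z → # (out z) < a → b ≤ # (inn z)
  few-out z o<a = +-cancelˡ-≤ a b _ (≤-trans (degree-split z) (+-monoˡ-≤ (# (inn z)) o<a))

  few-inn : ∀ z → # (inn z) < b → a ≤ # (out z)
  few-inn z d<b = +-cancelʳ-≤ b a _ (≤-trans (degree-split z)
    (≤-trans (≤-reflexive (sym (+-suc (# (out z)) (# (inn z))))) (+-monoʳ-≤ (# (out z)) d<b)))

  -- The image under `succ`, taken as a preimage under its inverse so that membership of `v` is a
  -- statement about `pred v`.
  succs : FinSet n → FinSet n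
  succs = preimage pred

  #-succs : (A : FinSet n) → # (succs A) ≡ # A
  #-succs = #-preimage pred succ pred-succ succ-pred

  pred∈⇒∈ : ∀ {v} → pred v ∈ C → v ∈ C
  pred∈⇒∈ {v} pv∈ = subst (_∈ C) (succ-pred v) (succ∈C pv∈)

  pred-cancel : ∀ {u v} → pred u ≡ pred v → u ≡ v
  pred-cancel {u} {v} eq = trans (sym (succ-pred u)) (trans (cong succ eq) (succ-pred v))

  forwards : (P : Fin n → Set) → (∀ {z} → z ∈ C → P z → P (succ z)) →
             ∀ {u v} → u ∈ C → P u → v ∈ C → P v
  forwards P next {u} {v} u∈ Pu v∈ with position u∈
  ... | i , refl with locate v∈ (suc i)
  ...   | j , _ , refl = go j
    where
    go : ∀ j → P (c (j + suc i))
    go zero    = Pu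
    go (suc j) = subst P (succ-c (j + suc i)) (next (c∈C (j + suc i)) (go j))

  backwards : (P : Fin n → Set) → (∀ {z} → z ∈ C → P (succ z) → P z) →
              ∀ {u v} → u ∈ C → P u → v ∈ C → P v
  backwards P next {u} {v} u∈ Pu v∈ with position v∈
  ... | i , refl with locate u∈ (suc i)
  ...   | j , _ , refl = go j Pu
    where
    go : ∀ j → P (c (j + suc i)) → P (c (suc i))
    go zero    p = p
    go (suc j) p = go j (next (c∈C (j + suc i)) (subst P (sym (succ-c (j + suc i))) p))

  insert✗ : ∀ {x v} → ¬ x ∈ C → v ∈ C → x ~ v → ¬ x ~ succ v
  insert✗ x∉ v∈ xv xsv = no-longer (insertion x∉ v∈ xv xsv)

  -- A bipartition from alternating neighbourhoods

  module Alternating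
    (alternate : ∀ {x v} → ¬ x ∈ C → v ∈ C → x ~ v → x ~ pred (pred v)) where

    alternate-succ : ∀ {w z} → ¬ w ∈ C → z ∈ C → w ~ succ (succ z) → w ~ z
    alternate-succ {w} {z} w∉ z∈ wssz = subst (w ~_)
      (trans (cong pred (pred-succ (succ z))) (pred-succ z)) (alternate w∉ (succ∈C (succ∈C z∈)) wssz)

    -- Going back in steps of two from `u`, every pair `v`, v⁺ contains a common neighbour. If `x`
    -- sees `v`, it cannot be v⁺, by `insert✗`.
    same-side : ∀ {x y u} → ¬ x ∈ C → ¬ y ∈ C → u ∈ C → x ~ u → y ~ u →
                ∀ {v} → v ∈ C → x ~ v → y ~ v
    same-side {x} {y} x∉ y∉ u∈ xu yu {v} v∈ xv
      with backwards (λ v → (x ~ v × y ~ v) ⊎ (x ~ succ v × y ~ succ v)) step u∈ (inj₁ (xu , yu)) v∈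
      where
      step : ∀ {z} → z ∈ C → (x ~ succ z × y ~ succ z) ⊎ (x ~ succ (succ z) × y ~ succ (succ z)) →
             (x ~ z × y ~ z) ⊎ (x ~ succ z × y ~ succ z)
      step z∈ (inj₁ both) = inj₂ both
      step z∈ (inj₂ (xssz , yssz)) = inj₁ (alternate-succ x∉ z∈ xssz , alternate-succ y∉ z∈ yssz)
    ... | inj₁ (_ , yv)  = yv
    ... | inj₂ (xsv , _) = contradiction xsv (insert✗ x∉ v∈ xv)

    -- Says that `x` and `y` see the two alternating classes of `C`; consecutive pairs express this
    -- without parities of positions.
    Opposite : Fin n → Fin n → Set
    Opposite x y = ∀ {v} → v ∈ C → (x ~ v × y ~ succ v) ⊎ (x ~ succ v × y ~ v)

    opposite : ∀ {x y z} → ¬ x ∈ C → ¬ y ∈ C → z ∈ C → x ~ z → y ~ succ z → Opposite x y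
    opposite {x} {y} x∉ y∉ z∈ xz ysz = backwards
      (λ v → (x ~ v × y ~ succ v) ⊎ (x ~ succ v × y ~ v)) step z∈ (inj₁ (xz , ysz))
      where
      step : ∀ {z} → z ∈ C →
             (x ~ succ z × y ~ succ (succ z)) ⊎ (x ~ succ (succ z) × y ~ succ z) →
             (x ~ z × y ~ succ z) ⊎ (x ~ succ z × y ~ z)
      step z∈ (inj₁ (xsz , yssz)) = inj₂ (xsz , alternate-succ y∉ z∈ yssz)
      step z∈ (inj₂ (xssz , ysz)) = inj₁ (alternate-succ x∉ z∈ xssz , ysz)

    swap-opposite : ∀ {x y} → Opposite x y → Opposite y x
    swap-opposite opp v∈ with opp v∈
    ... | inj₁ (xv , ysv) = inj₂ (ysv , xv)
    ... | inj₂ (xsv , yv) = inj₁ (yv , xsv)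

    not-both : ∀ {x y} → ¬ x ∈ C → ¬ y ∈ C → Opposite x y → ∀ {v} → v ∈ C → x ~ v → ¬ y ~ v
    not-both x∉ y∉ opp v∈ xv yv with opp v∈
    ... | inj₁ (_ , ysv) = insert✗ y∉ v∈ yv ysv
    ... | inj₂ (xsv , _) = insert✗ x∉ v∈ xv xsv

    pred-opposite : ∀ {x y} → ¬ x ∈ C → ¬ y ∈ C → Opposite x y → ∀ {v} → v ∈ C → x ~ v → y ~ pred v
    pred-opposite {x} {y} x∉ y∉ opp {v} v∈ xv with opp (pred∈C v∈)
    ... | inj₂ (_ , ypv) = ypv
    ... | inj₁ (_ , yspv) = contradiction (subst (y ~_) (succ-pred v) yspv) (not-both x∉ y∉ opp v∈ xv)

    -- One side of the bipartition: the neighbours of x on the cycle, and those of w off it.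
    side : Fin n → Fin n → FinSet n
    side x w = (N x ∩ C) ∪ (N w ∖ C)

    -- An edge between two neighbours of `x` on `C` gives a crossing through `y`, which sees their
    -- predecessors. For an edge between two neighbours of `w` off `C`, one end also sees w⁻⁻, and
    -- the edge replaces w⁻. A neighbour of `w` off `C` sees the same class as `y`, which excludes
    -- mixed edges.
    side-independent : ∀ {x y w} → ¬ x ∈ C → ¬ y ∈ C → Opposite x y → w ∈ C → y ~ w →
                       Independent (side x w)
    side-independent {x} {y} x∉ y∉ opp w∈ yw = λ
      { (inj₁ (xu , u∈)) (inj₁ (xv , v∈)) uv → no-longer (crossing y∉ (pred∈C u∈) (pred∈C v∈)
          (~⇒≢ uv ∘ pred-cancel) (pred-opposite x∉ y∉ opp u∈ xu) (pred-opposite x∉ y∉ opp v∈ xv)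
          (subst₂ _~_ (sym (succ-pred _)) (sym (succ-pred _)) uv))
      ; (inj₁ (xu , u∈)) (inj₂ (wv , v∉)) uv → mixed u∈ xu v∉ wv uv
      ; (inj₂ (wu , u∉)) (inj₁ (xv , v∈)) uv → mixed v∈ xv u∉ wu (~-sym uv)
      ; (inj₂ (wu , u∉)) (inj₂ (wv , v∉)) uv → no-longer (detour₂ u∉ v∉ (pred∈C w∈)
          (subst (_ ~_) (sym (succ-pred _)) (~-sym wu)) (alternate v∉ w∈ (~-sym wv)) uv) }
      where
      mixed : ∀ {u v} → u ∈ C → x ~ u → ¬ v ∈ C → _ ~ v → ¬ u ~ v
      mixed u∈ xu v∉ wv uv = not-both x∉ y∉ opp u∈ xu
        (same-side v∉ y∉ w∈ (~-sym wv) yw u∈ (~-sym uv))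

    -- Both sides are independent, and `Opposite` places every vertex of `C`. What remains is that
    -- each vertex off `C` sees `z` or z⁺, shown in `attached`.
    bipartite-graph : ∀ {x y z} → ¬ x ∈ C → ¬ y ∈ C → z ∈ C → x ~ z → y ~ succ z →
                      IsBalancedCompleteBipartite G
    bipartite-graph {x} {y} {z} x∉ y∉ z∈ xz ysz = bipartite odd
      (λ u∈ uv v∈ → odd-independent u∈ v∈ uv)
      (λ {u} {v} u∉ uv → decidable-stable (mem? odd v) λ v∉ →
        even-independent (not-odd u∉) (not-odd v∉) uv)
      z
      where
      opp : Opposite x y
      opp = opposite x∉ y∉ z∈ xz ysz
      odd even : FinSet n
      odd  = side x (succ z)
      even = side y z
      odd-independent : Independent odd
      odd-independent = side-independent x∉ y∉ opp (succ∈C z∈) ysz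
      even-independent : Independent even
      even-independent = side-independent y∉ x∉ (swap-opposite opp) z∈ xz
      either : ∀ {v} → v ∈ C → x ~ v ⊎ y ~ v
      either v∈ with opp v∈
      ... | inj₁ (xv , _) = inj₁ xv
      ... | inj₂ (_ , yv) = inj₂ yv
      Nz⊆even : N z ⊆ even
      Nz⊆even {v} zv with mem? C v
      ... | no v∉ = inj₂ (zv , v∉)
      ... | yes v∈ with either v∈
      ...   | inj₁ xv = contradiction zv (odd-independent (inj₁ (xz , z∈)) (inj₁ (xv , v∈)))
      ...   | inj₂ yv = inj₁ (yv , v∈)
      Nsz⊆odd : N (succ z) ⊆ odd
      Nsz⊆odd {v} szv with mem? C v
      ... | no v∉ = inj₂ (szv , v∉)
      ... | yes v∈ with either v∈
      ...   | inj₁ xv = inj₁ (xv , v∈)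
      ...   | inj₂ yv = contradiction szv (even-independent (inj₁ (ysz , succ∈C z∈)) (inj₁ (yv , v∈)))
      attached : ∀ {w} → ¬ w ∈ C → w ~ z ⊎ w ~ succ z
      attached {w} w∉ with adj? G w z | adj? G w (succ z)
      ... | yes wz | _      = inj₁ wz
      ... | no _   | yes wsz = inj₂ wsz
      -- Such a `w` has no neighbour on `C`, by `same-side`. It shares a neighbour `p` with `z` and
      -- `q` with z⁺, since `N z` and `N (succ z)` are large independent sets. Alternation takes `q`
      -- back from z⁺ to z⁻⁻⁻, so the path `q`, `w`, `p` replaces z⁻⁻ and z⁻.
      ... | no ¬wz | no ¬wsz = contradiction
            (detour₃ (off wq) w∉ (off wp) (pred∈C (pred∈C (pred∈C z∈)))
              (alternate (off wq) (pred∈C z∈)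
                (subst (λ v → q ~ pred v) (pred-succ z) (alternate (off wq) (succ∈C z∈) (~-sym szq))))
              (~-sym wq) wp (λ q≡p → insert✗ (off wp) z∈ (~-sym zp) (~-sym (subst (succ z ~_) q≡p szq)))
              (subst (p ~_) (sym (trans (cong (succ ∘ succ) (succ-pred (pred (pred z))))
                                   (trans (cong succ (succ-pred (pred z))) (succ-pred z)))) (~-sym zp)))
            no-longer
        where
        off : ∀ {v} → w ~ v → ¬ v ∈ C
        off wv v∈ with either v∈
        ... | inj₁ xv = ¬wz (same-side x∉ w∉ v∈ xv wv z∈ xz)
        ... | inj₂ yv = ¬wsz (same-side y∉ w∉ v∈ yv wv (succ∈C z∈) ysz)
        common : ∀ u → Independent (N u) → ¬ u ~ w → ∃[ v ] u ~ v × w ~ v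
        common u ind ¬uw = #-inhabited (N u ∩ N w)
          (≤-trans 0<a (≤-trans a≤b (many-neighbours (N u) ind (a+b≤1+#N u) ¬uw)))
        to-z = common z (λ u∈ v∈ → even-independent (Nz⊆even u∈) (Nz⊆even v∈)) (¬wz ∘ ~-sym)
        to-sz = common (succ z) (λ u∈ v∈ → odd-independent (Nsz⊆odd u∈) (Nsz⊆odd v∈)) (¬wsz ∘ ~-sym)
        p = proj₁ to-z
        zp = proj₁ (proj₂ to-z)
        wp = proj₂ (proj₂ to-z)
        q = proj₁ to-sz
        szq = proj₁ (proj₂ to-sz)
        wq = proj₂ (proj₂ to-sz)
      not-odd : ∀ {v} → ¬ v ∈ odd → v ∈ even
      not-odd {v} v∉odd with mem? C v
      ... | yes v∈ with either v∈
      ...   | inj₁ xv = contradiction (inj₁ (xv , v∈)) v∉odd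
      ...   | inj₂ yv = inj₁ (yv , v∈)
      not-odd {v} v∉odd | no v∉ with attached v∉
      ...   | inj₁ vz  = inj₂ (~-sym vz , v∉)
      ...   | inj₂ vsz = contradiction (inj₂ (~-sym vsz , v∉)) v∉odd

  -- Otherwise `inn z` would have at least `b` elements, and by `rotation` no vertex of
  -- `out (succ z)` sees their successors. Applied backwards round the cycle, this carries the bound
  -- from one vertex to all.
  heavy-pred : ∀ {z} → z ∈ C → a ≤ # (out (succ z)) → a ≤ # (out z)
  heavy-pred {z} z∈ a≤ = few-inn z (≰⇒> λ b≤ → gap b≤ (subset (out (succ z)) a a≤))
    where
    open ≤-Reasoning
    gap : b ≤ # (inn z) → ¬ (∃[ A ] A ⊆ out (succ z) × # A ≡ a)
    gap b≤ (A , A⊆ , #A) = no-gap A (succs (inn z)) #A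
      (begin
        a + b                      ≤⟨ +-monoʳ-≤ a b≤ ⟩
        a + # (inn z)              ≡⟨ cong₂ _+_ #A (#-succs (inn z)) ⟨
        # A + # (succs (inn z))    ≤⟨ #-∪ {A = A} {succs (inn z)}
                                        (λ v∈A (_ , pv∈) → proj₂ (A⊆ v∈A) (pred∈⇒∈ pv∈)) ⟩
        # (A ∪ succs (inn z))      ∎)
      λ x∈A (zq , q∈) xy → no-longer (rotation (proj₂ (A⊆ x∈A)) z∈ q∈ zq (~-sym (proj₁ (A⊆ x∈A)))
        (subst (_ ~_) (sym (succ-pred _)) xy))

  -- The case of many neighbours off the cycle

  module Heavy (heavy : ∀ {v} → v ∈ C → a ≤ # (out v)) where

    Minimal : Fin n → Set
    Minimal z = ∀ {v} → v ∈ C → # (out z) ≤ # (out v)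

    minimal : ∃[ z ] z ∈ C × Minimal z
    minimal with least (λ k → any? λ z → mem? C z ×-dec (# (out z) ≟ℕ k)) _ (c 0 , c∈C 0 , refl)
    ... | _ , (z , z∈ , refl) , least-z = z , z∈ , λ {v} v∈ → least-z _ (v , v∈ , refl)

    module _ {z : Fin n} (z∈ : z ∈ C) (z-min : Minimal z) where

      private
        B : FinSet n
        B = succs (inn z) ∪ out (pred z)

        no-edge : ∀ {x y} → x ∈ out (succ z) → y ∈ B → ¬ x ~ y
        no-edge (szx , x∉) (inj₁ (zq , q∈)) xy = no-longer
          (rotation x∉ z∈ q∈ zq (~-sym szx) (subst (_ ~_) (sym (succ-pred _)) xy))
        no-edge (szx , x∉) (inj₂ (pzy , y∉)) xy = no-longer
          (detour₂ x∉ y∉ z∈ (~-sym szx) (~-sym pzy) xy)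

        #B : # (inn z) + # (out (pred z)) ≤ # B
        #B = ≤-trans (≤-reflexive (cong (_+ # (out (pred z))) (sym (#-succs (inn z)))))
          (#-∪ {A = succs (inn z)} {out (pred z)} λ (_ , pv∈) (_ , v∉) → v∉ (pred∈⇒∈ pv∈))

        open ≤-Reasoning

      -- By `rotation` and `detour₂`, no vertex of `out (succ z)` sees `B`. If `out (pred z)` were
      -- larger than `out z`, the degree of `z` would give `B` at least `a + b` elements.
      out-pred-small : # (out (pred z)) ≤ # (out z)
      out-pred-small = ≮⇒≥ λ lt → gap lt (subset (out (succ z)) a (heavy (succ∈C z∈)))
        where
        gap : # (out z) < # (out (pred z)) → ¬ (∃[ A ] A ⊆ out (succ z) × # A ≡ a)
        gap lt (A , A⊆ , #A) = no-gap A B #A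
          (begin
            a + b                              ≤⟨ degree-split z ⟩
            suc (# (out z)) + # (inn z)        ≤⟨ +-monoˡ-≤ (# (inn z)) lt ⟩
            # (out (pred z)) + # (inn z)       ≡⟨ +-comm (# (out (pred z))) (# (inn z)) ⟩
            # (inn z) + # (out (pred z))       ≤⟨ #B ⟩
            # B                                ≤⟨ #-mono {A = B} {A ∪ B} inj₂ ⟩
            # (A ∪ B)                          ∎)
          λ x∈A y∈B → no-edge (A⊆ x∈A) y∈B

      -- Minimality gives `B` at least `a + b - 1` elements. A vertex `w` of `out (succ z)` not in
      -- `out (pred z)` lies outside `B`, and placing it in `A` completes the count.
      out-succ⊆out-pred : out (succ z) ⊆ out (pred z)
      out-succ⊆out-pred {w} w∈ = decidable-stable (mem? (out (pred z)) w) λ w∉ →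
        gap w∉ (between ｛ w ｝ (out (succ z)) a (λ { refl → w∈ })
                 (≤-trans (≤-reflexive (#-｛｝ w)) 0<a) (heavy (succ∈C z∈)))
        where
        gap : ¬ w ∈ out (pred z) → ¬ (∃[ A ] ｛ w ｝ ⊆ A × A ⊆ out (succ z) × # A ≡ a)
        gap w∉ (A , w∈A , A⊆ , #A) = no-gap A B #A
          (begin
            a + b                              ≤⟨ degree-split z ⟩
            suc (# (out z) + # (inn z))        ≤⟨ s≤s (+-monoˡ-≤ (# (inn z)) (z-min (pred∈C z∈))) ⟩
            suc (# (out (pred z)) + # (inn z)) ≡⟨ cong suc (+-comm (# (out (pred z))) (# (inn z))) ⟩
            1 + (# (inn z) + # (out (pred z))) ≤⟨ +-mono-≤ (≤-reflexive (sym (#-｛｝ w))) #B ⟩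
            # ｛ w ｝ + # B                    ≤⟨ #-superadditive {A = ｛ w ｝} {B} {A ∪ B} w∉B
                                                    (λ { refl → inj₁ (w∈A refl) }) inj₂ ⟩
            # (A ∪ B)                          ∎)
          λ x∈A y∈B → no-edge (A⊆ x∈A) y∈B
          where
          w∉B : ∀ {v} → v ≡ w → ¬ v ∈ B
          w∉B refl (inj₁ (_ , pw∈)) = proj₂ w∈ (pred∈⇒∈ pw∈)
          w∉B refl (inj₂ w∈pred)    = w∉ w∈pred

      -- Minimality thus passes round the whole cycle, and the inclusion above becomes available at
      -- every vertex of `C`.
      succ-minimal : Minimal (succ z)
      succ-minimal {v} v∈ = begin
        # (out (succ z))  ≤⟨ #-mono {A = out (succ z)} {out (pred z)} out-succ⊆out-pred ⟩
        # (out (pred z))  ≤⟨ out-pred-small ⟩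
        # (out z)         ≤⟨ z-min v∈ ⟩
        # (out v)         ∎

    all-minimal : ∀ {z} → z ∈ C → Minimal z
    all-minimal z∈ = forwards Minimal succ-minimal (proj₁ (proj₂ minimal)) (proj₂ (proj₂ minimal)) z∈

    alternate : ∀ {x v} → ¬ x ∈ C → v ∈ C → x ~ v → x ~ pred (pred v)
    alternate {x} {v} x∉ v∈ xv = ~-sym (proj₁ (out-succ⊆out-pred (pred∈C v∈) (all-minimal (pred∈C v∈))
      (~-sym (subst (x ~_) (sym (succ-pred v)) xv) , x∉)))

    heavy-conclusion : IsBalancedCompleteBipartite G
    heavy-conclusion =
      let x , zx , x∉   = #-inhabited (out (c 0)) (≤-trans 0<a (heavy (c∈C 0)))
          y , szy , y∉  = #-inhabited (out (succ (c 0))) (≤-trans 0<a (heavy (succ∈C (c∈C 0))))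
      in Alternating.bipartite-graph alternate x∉ y∉ (c∈C 0) (~-sym zx) (~-sym szy)

  -- The case of few neighbours off the cycle

  module Light (light : ∀ {v} → v ∈ C → # (out v) < a) where

    Touching : Fin n → Set
    Touching x = ∃[ v ] v ∈ C × x ~ v

    touching? : ∀ x → Dec (Touching x)
    touching? x = any? λ v → mem? C v ×-dec adj? G x v

    module _ {x z : Fin n} (x∉ : ¬ x ∈ C) (z∈ : z ∈ C) (xsz : x ~ succ z) where

      private
        D : FinSet n
        D = inn z ∖ ｛ pred z ｝

        -- The ends q⁺⁺ of the rotations along chords from `z` to `q` that insert `x` and a
        -- neighbour of it; `D` leaves out z⁻, which `rotation₂` excludes.
        B : FinSet n
        B = succs (succs D)

        #D : # (inn z) ≤ suc (# B)
        #D = begin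
          # (inn z)             ≤⟨ #-subadditive {A = inn z} {｛ pred z ｝} {D} split ⟩
          # ｛ pred z ｝ + # D  ≡⟨ cong₂ _+_ (#-｛｝ (pred z))
                                     (sym (trans (#-succs (succs D)) (#-succs D))) ⟩
          suc (# B)             ∎
          where
          open ≤-Reasoning
          split : ∀ {v} → v ∈ inn z → v ∈ ｛ pred z ｝ ⊎ v ∈ D
          split {v} v∈ with v ≟ pred z
          ... | yes eq = inj₁ eq
          ... | no neq = inj₂ (v∈ , neq)

        B⊆C : B ⊆ C
        B⊆C ((_ , v∈) , _) = pred∈⇒∈ (pred∈⇒∈ v∈)

        no-edge-B : ∀ {t v} → t ∈ out x → v ∈ B → ¬ t ~ v
        no-edge-B (xt , t∉) ((zq , q∈) , q≢) tv = no-longer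
          (rotation₂ t∉ x∉ z∈ q∈ (~-sym xt) xsz zq q≢
            (subst (_ ~_) (sym (trans (cong succ (succ-pred _)) (succ-pred _))) tv))

      -- If |inn z| ≥ b, then out x and B together fall short of a contradiction by one vertex only.
      few-extra : a ≤ # (out x) → (E : FinSet n) → suc b ≤ # E + # (inn z) →
                  Disjoint E B → Disjoint E (out x) → (∀ {t e} → t ∈ out x → e ∈ E → ¬ t ~ e) → ⊥
      few-extra a≤ E large E∩B E∩out no-edge-E = gap (subset (out x) a a≤)
        where
        open ≤-Reasoning
        gap : ¬ (∃[ A ] A ⊆ out x × # A ≡ a)
        gap (A , A⊆ , #A) = no-gap A (E ∪ B) #A
          (begin
            a + b              ≤⟨ +-monoʳ-≤ a (≤-pred (≤-trans large (≤-trans (+-monoʳ-≤ (# E) #D)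
                                    (≤-reflexive (+-suc (# E) (# B)))))) ⟩
            a + (# E + # B)    ≤⟨ +-mono-≤ (≤-reflexive (sym #A)) (#-∪ {A = E} {B} E∩B) ⟩
            # A + # (E ∪ B)    ≤⟨ #-∪ {A = A} {E ∪ B} disjoint ⟩
            # (A ∪ E ∪ B)      ∎)
          λ { x∈A (inj₁ e∈) → no-edge-E (A⊆ x∈A) e∈ ; x∈A (inj₂ v∈) → no-edge-B (A⊆ x∈A) v∈ }
          where
          disjoint : Disjoint A (E ∪ B)
          disjoint v∈A (inj₁ v∈E) = E∩out v∈E (A⊆ v∈A)
          disjoint v∈A (inj₂ v∈B) = proj₂ (A⊆ v∈A) (B⊆C v∈B)

      -- Since `inn z` has at least `b` elements, a single vertex completes the count. So every
      -- vertex outside `B` and `out x` is seen from `out x`; this is applied to z⁻, to z⁺ and to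
      -- the vertices of `out z`.
      no-extra : a ≤ # (out x) → ∀ e → ¬ e ∈ B → ¬ e ∈ out x → ¬ (∀ {t} → t ∈ out x → ¬ t ~ e)
      no-extra a≤ e e∉B e∉out no-edge-e = few-extra a≤ ｛ e ｝
        (+-mono-≤ (≤-reflexive (sym (#-｛｝ e))) (few-out z (light z∈)))
        (λ { refl → e∉B }) (λ { refl → e∉out }) (λ { t∈ refl → no-edge-e t∈ })

      -- The conclusion makes `z` see z⁻⁻⁻, the chord that `handle` needs. Otherwise some `t` in
      -- `out x` sees z⁻, and `t`, `x` replace `z`.
      many-out⇒pred∈B : a ≤ # (out x) → pred z ∈ B
      many-out⇒pred∈B a≤ = decidable-stable (mem? B (pred z)) λ pz∉ → no-extra a≤ (pred z) pz∉
        (λ (_ , pz∉C) → pz∉C (pred∈C z∈))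
        (λ (xt , t∉) tpz → no-longer (detour₂ x∉ t∉ z∈ xsz tpz xt))

      -- With `E` empty, `few-extra` leaves `inn z` at most `b` elements, so `out z` has at least
      -- `a - 1`. This is positive because `x` is in `out (succ z)`, which has fewer than `a`
      -- elements.
      many-out⇒out-inhabited : a ≤ # (out x) → ∃ (_∈ out z)
      many-out⇒out-inhabited a≤ = #-inhabited (out z) (≤-pred (≤-trans 2≤a (+-cancelʳ-≤ b a (suc (# (out z)))
        (≤-trans (degree-split z) (s≤s (+-monoʳ-≤ (# (out z)) inn-small))))))
        where
        inn-small : # (inn z) ≤ b
        inn-small = ≮⇒≥ λ b< → few-extra a≤ ∅ (≤-trans b< (m≤n+m (# (inn z)) (# {n} ∅)))
          (λ ()) (λ ()) (λ _ ())
        2≤a : 2 ≤ a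
        2≤a = ≤-trans (s≤s (#-positive (out (succ z)) (~-sym xsz , x∉))) (light (succ∈C z∈))

      many-out⇒triangle : a ≤ # (out x) → ∃[ u ] u ∈ out x × u ~ succ z
      many-out⇒triangle a≤ = decidable-stable (any? λ u → mem? (out x) u ×-dec adj? G u (succ z)) λ none →
        no-extra a≤ (succ z) (λ (_ , neq) → neq (cong pred (pred-succ z)))
          (λ (_ , sz∉) → sz∉ (succ∈C z∈)) (λ t∈ tsz → none (_ , t∈ , tsz))

      module _ {q : Fin n} (q∈ : q ∈ C) (zq : z ~ q) (sssq : succ (succ (succ q)) ≡ z) where

        -- A vertex `y` of `out z` not seen by `x` would be seen by some `t` in `out x`, and
        -- `handle` inserts the path `y`, `t`, `x`.
        many-out⇒out⊆out : a ≤ # (out x) → out z ⊆ out x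
        many-out⇒out⊆out a≤ {y} (zy , y∉) = decidable-stable (mem? (out x) y) λ y∉x → no-extra a≤ y
          (λ y∈B → y∉ (B⊆C y∈B)) y∉x
          (λ (xt , t∉) ty → no-longer (handle x∉ t∉ y∉ z∈ q∈ sssq zq (~-sym zy) (~-sym ty) (~-sym xt)
            (λ y≡x → insert✗ x∉ z∈ (~-sym (subst (z ~_) y≡x zy)) xsz) xsz))

        no-handle : ∀ {y u} → y ∈ out z → y ∈ out x → u ∈ out x → ¬ u ~ succ z
        no-handle (zy , y∉) (xy , _) (xu , u∉) usz = no-longer
          (handle u∉ x∉ y∉ z∈ q∈ sssq zq (~-sym zy) (~-sym xy) xu
            (λ y≡u → insert✗ u∉ z∈ (~-sym (subst (z ~_) y≡u zy)) usz) usz)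

      -- With `a` or more neighbours off `C`, `x` would see some `y` in `out z` and some `u` off `C`
      -- that sees z⁺. The path `y`, `x`, `u` from `z` to z⁺ is excluded by `no-handle`.
      out-small-succ : # (out x) < a
      out-small-succ = ≰⇒> λ a≤ →
        refute a≤ (many-out⇒pred∈B a≤) (many-out⇒out-inhabited a≤) (many-out⇒triangle a≤)
        where
        sss : ∀ v → succ (succ (succ (pred (pred (pred v))))) ≡ v
        sss v = trans (cong (succ ∘ succ) (succ-pred (pred (pred v))))
                      (trans (cong succ (succ-pred (pred v))) (succ-pred v))
        refute : a ≤ # (out x) → pred z ∈ B → ∃ (_∈ out z) → ¬ (∃[ u ] u ∈ out x × u ~ succ z)
        refute a≤ ((zq , q∈) , _) (y , y∈) (u , u∈ , usz) =
          no-handle q∈ zq (sss z) y∈ (many-out⇒out⊆out q∈ zq (sss z) a≤ y∈) u∈ usz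

    out-small : ∀ {x} → ¬ x ∈ C → Touching x → # (out x) < a
    out-small {x} x∉ (v , v∈ , xv) = out-small-succ x∉ (pred∈C v∈) (subst (x ~_) (sym (succ-pred v)) xv)

    inn-large : ∀ {x} → ¬ x ∈ C → Touching x → b ≤ # (inn x)
    inn-large {x} x∉ touch = few-out x (out-small x∉ touch)

    -- If no neighbour of `x` off `C` sees `C`, then `X` receives no edge from `x` by `insertion`,
    -- none from `out x`, and none from itself by `crossing`. Since `A₀` has at most `a` elements, a
    -- set of size `a` can be chosen around it, and its union with `X` has at least `a + b`.
    partner : ∀ {x} → ¬ x ∈ C → Touching x → ∃[ u ] u ∈ out x × Touching u
    partner {x} x∉ touch = decidable-stable (any? λ u → mem? (out x) u ×-dec touching? u) λ none →
      gap none (between A₀ (A₀ ∪ X) a inj₁ #A₀ large)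
      where
      open ≤-Reasoning
      X A₀ : FinSet n
      X = succs (inn x)
      A₀ = ｛ x ｝ ∪ out x
      #A₀ : # A₀ ≤ a
      #A₀ = ≤-trans (#-subadditive {A = A₀} {｛ x ｝} {out x} id)
        (≤-trans (≤-reflexive (cong (_+ # (out x)) (#-｛｝ x))) (out-small x∉ touch))
      large : a ≤ # (A₀ ∪ X)
      large = begin
        a              ≤⟨ a≤b ⟩
        b              ≤⟨ inn-large x∉ touch ⟩
        # (inn x)      ≡⟨ #-succs (inn x) ⟨
        # X            ≤⟨ #-mono {A = X} {A₀ ∪ X} inj₂ ⟩
        # (A₀ ∪ X)     ∎
      gap : ¬ (∃[ u ] u ∈ out x × Touching u) → ¬ (∃[ A ] A₀ ⊆ A × A ⊆ A₀ ∪ X × # A ≡ a)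
      gap none (A , ⊆A , A⊆ , #A) = no-gap A X #A
        (begin
          a + b                          ≤⟨ degree-split x ⟩
          1 + # (out x) + # (inn x)      ≡⟨ cong₂ (λ i j → i + # (out x) + j) (#-｛｝ x) (#-succs (inn x)) ⟨
          # ｛ x ｝ + # (out x) + # X    ≤⟨ +-monoˡ-≤ (# X) (#-∪ {A = ｛ x ｝} {out x}
                                              (λ { refl (xx , _) → ~⇒≢ xx refl })) ⟩
          # A₀ + # X                     ≤⟨ #-superadditive {A = A₀} {X} {A ∪ X} A₀∩X
                                              (λ v∈ → inj₁ (⊆A v∈)) inj₂ ⟩
          # (A ∪ X)                      ∎)
        λ y∈A → no-edge (A⊆ y∈A)
        where
        A₀∩X : Disjoint A₀ X
        A₀∩X (inj₁ refl) (_ , px∈)     = x∉ (pred∈⇒∈ px∈)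
        A₀∩X (inj₂ (_ , v∉)) (_ , pv∈) = v∉ (pred∈⇒∈ pv∈)
        no-edge : ∀ {y v} → y ∈ A₀ ∪ X → v ∈ X → ¬ y ~ v
        no-edge (inj₁ (inj₁ refl)) (xpv , pv∈) xv =
          insert✗ x∉ pv∈ xpv (subst (x ~_) (sym (succ-pred _)) xv)
        no-edge (inj₁ (inj₂ y∈)) (_ , pv∈) yv = none (_ , y∈ , _ , pred∈⇒∈ pv∈ , yv)
        no-edge (inj₂ (xpy , py∈)) (xpv , pv∈) yv = no-longer (crossing x∉ py∈ pv∈
          (λ eq → ~⇒≢ yv (pred-cancel eq)) xpy xpv
          (subst₂ _~_ (sym (succ-pred _)) (sym (succ-pred _)) yv))

    module _ {x u : Fin n} (x∉ : ¬ x ∈ C) (u∉ : ¬ u ∈ C) (xu : x ~ u) where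

      private
        X : FinSet n
        X = succs (inn x)

      -- Pushing the elements of X outside A one step further keeps them apart from those inside A.
      many-pushed : (A : FinSet n) (e : Fin n) → e ∈ C → ¬ e ∈ X ∩ A → ¬ e ∈ succs X →
                    a + b ≤ # ((out x ∪ ｛ e ｝) ∪ (X ∩ A) ∪ succs (X ∖ A))
      many-pushed A e e∈ e∉X∩A e∉sX = begin
        a + b                                                    ≤⟨ degree-split x ⟩
        suc (# (out x) + # (inn x))                              ≡⟨ cong (_+ # (inn x)) (+-comm 1 (# (out x))) ⟩
        # (out x) + 1 + # (inn x)                                ≡⟨ cong₂ (λ i j → # (out x) + i + j) (#-｛｝ e) (#-succs (inn x)) ⟨
        # (out x) + # ｛ e ｝ + # X                              ≤⟨ +-mono-≤
          (#-∪ {A = out x} {｛ e ｝} λ { (_ , e∉) refl → e∉ e∈ })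
          (≤-trans (#-subadditive {A = X} {X ∩ A} {X ∖ A} split)
            (≤-trans (≤-reflexive (cong (# (X ∩ A) +_) (sym (#-succs (X ∖ A)))))
              (#-∪ {A = X ∩ A} {succs (X ∖ A)} pushed-apart))) ⟩
        # (out x ∪ ｛ e ｝) + # ((X ∩ A) ∪ succs (X ∖ A))        ≤⟨ #-∪ {A = out x ∪ ｛ e ｝} {(X ∩ A) ∪ succs (X ∖ A)} apart ⟩
        # ((out x ∪ ｛ e ｝) ∪ (X ∩ A) ∪ succs (X ∖ A))          ∎
        where
        open ≤-Reasoning
        split : ∀ {v} → v ∈ X → v ∈ X ∩ A ⊎ v ∈ X ∖ A
        split {v} v∈ with mem? A v
        ... | yes v∈A = inj₁ (v∈ , v∈A)
        ... | no  v∉A = inj₂ (v∈ , v∉A)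
        pushed-apart : Disjoint (X ∩ A) (succs (X ∖ A))
        pushed-apart ((xpv , _) , _) ((xppv , ppv∈) , _) =
          insert✗ x∉ ppv∈ xppv (subst (x ~_) (sym (succ-pred _)) xpv)
        apart : Disjoint (out x ∪ ｛ e ｝) ((X ∩ A) ∪ succs (X ∖ A))
        apart (inj₁ (_ , v∉)) (inj₁ ((_ , pv∈) , _)) = v∉ (pred∈⇒∈ pv∈)
        apart (inj₁ (_ , v∉)) (inj₂ ((_ , ppv∈) , _)) = v∉ (pred∈⇒∈ (pred∈⇒∈ ppv∈))
        apart (inj₂ refl) (inj₁ e∈X∩A) = e∉X∩A e∈X∩A
        apart (inj₂ refl) (inj₂ (e∈sX , _)) = e∉sX e∈sX

      -- Write `v` as q⁺⁺ with `q` in `inn x`. An edge from `out x` gives `detour₂` around q⁺, an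
      -- edge from a successor of `inn u` gives `crossing₂`. Its condition that `q` differs from y⁻
      -- holds because q⁺ is outside `A`.
      no-edge-pushed : (A : FinSet n) → A ⊆ out x ∪ succs (inn u) →
                       ∀ {y v} → y ∈ A → v ∈ succs (X ∖ A) → ¬ y ~ v
      no-edge-pushed A A⊆ {y} {v} y∈A ((xq , q∈) , pv∉A) yv with A⊆ y∈A
      ... | inj₁ (xy , y∉) = no-longer (detour₂ y∉ x∉ (pred∈⇒∈ q∈)
              (subst (y ~_) (sym (succ-pred v)) yv) xq (~-sym xy))
      ... | inj₂ (upy , py∈) = no-longer (crossing₂ x∉ u∉ q∈ py∈ xu xq upy
              (λ eq → pv∉A (subst (_∈ A) (trans (sym (succ-pred y)) (trans (cong succ (sym eq)) (succ-pred (pred v)))) y∈A))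
              (λ eq → ~⇒≢ yv (pred-cancel (trans eq (succ-pred (pred v)))))
              (subst₂ _~_ (sym (trans (cong succ (succ-pred (pred v))) (succ-pred v)))
                          (sym (succ-pred y)) (~-sym yv)))

      -- If `x` saw neither `e` nor e⁻, then e⁺ would be neither one nor two steps after a neighbour
      -- of `x` on `C`. It can then join `A` as the one vertex by which the neighbours of `x` fall
      -- short of `a + b`.
      pred-of-other : Touching x → Touching u → ∀ {e} → e ∈ C → u ~ e → ¬ x ~ e → x ~ pred e
      pred-of-other x-touch u-touch {e} e∈ ue ¬xe = decidable-stable (adj? G x (pred e)) λ ¬xpe →
        gap ¬xpe (between A₀ A₁ a A₀⊆A₁ #A₀ large)
        where
        open ≤-Reasoning
        A₀ A₁ : FinSet n
        A₀ = out x ∪ ｛ succ e ｝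
        A₁ = out x ∪ succs (inn u)
        A₀⊆A₁ : A₀ ⊆ A₁
        A₀⊆A₁ (inj₁ v∈)   = inj₁ v∈
        A₀⊆A₁ (inj₂ refl) = inj₂ (subst (_∈ inn u) (sym (pred-succ e)) (ue , e∈))
        #A₀ : # A₀ ≤ a
        #A₀ = begin
          # A₀                          ≤⟨ #-subadditive {A = A₀} {out x} {｛ succ e ｝} id ⟩
          # (out x) + # ｛ succ e ｝    ≡⟨ cong (# (out x) +_) (#-｛｝ (succ e)) ⟩
          # (out x) + 1                 ≡⟨ +-comm (# (out x)) 1 ⟩
          suc (# (out x))               ≤⟨ out-small x∉ x-touch ⟩
          a                             ∎
        large : a ≤ # A₁
        large = begin
          a                    ≤⟨ a≤b ⟩
          b                    ≤⟨ inn-large u∉ u-touch ⟩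
          # (inn u)            ≡⟨ #-succs (inn u) ⟨
          # (succs (inn u))    ≤⟨ #-mono {A = succs (inn u)} {A₁} inj₂ ⟩
          # A₁                 ∎
        gap : ¬ x ~ pred e → ¬ (∃[ A ] A₀ ⊆ A × A ⊆ A₁ × # A ≡ a)
        gap ¬xpe (A , ⊆A , A⊆ , #A) = no-gap A (succs (X ∖ A)) #A
          (≤-trans
            (many-pushed A (succ e) (succ∈C e∈)
              (λ ((xpse , _) , _) → ¬xe (subst (x ~_) (pred-succ e) xpse))
              (λ (xppse , _) → ¬xpe (subst (λ v → x ~ pred v) (pred-succ e) xppse)))
            (#-mono {A = (out x ∪ ｛ succ e ｝) ∪ (X ∩ A) ∪ succs (X ∖ A)} {A ∪ succs (X ∖ A)}
              λ { (inj₁ v∈) → inj₁ (⊆A v∈) ; (inj₂ (inj₁ (_ , v∈A))) → inj₁ v∈A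
                ; (inj₂ (inj₂ v∈)) → inj₂ v∈ }))
          (no-edge-pushed A A⊆)

    -- Here e⁺ is kept out of `A` and put on the other side. It lies in `X`, so it contributes
    -- twice: as e⁺ and, pushed, as e⁺⁺.
    no-common : ∀ {x u} → ¬ x ∈ C → ¬ u ∈ C → x ~ u → ∀ {e} → e ∈ C → x ~ e → ¬ u ~ e
    no-common {x} {u} x∉ u∉ xu {e} e∈ xe ue =
      gap (between (out x) A₁ a inj₁ (<⇒≤ (out-small x∉ x-touch)) large)
      where
      open ≤-Reasoning
      x-touch : Touching x
      x-touch = e , e∈ , xe
      u-touch : Touching u
      u-touch = e , e∈ , ue
      X A₁ : FinSet n
      X = succs (inn x)
      A₁ = out x ∪ (succs (inn u) ∖ ｛ succ e ｝)
      -- `out x` contains `u`, which makes up for the removal of e⁺.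
      large : a ≤ # A₁
      large = begin
        a                                                    ≤⟨ a≤b ⟩
        b                                                    ≤⟨ inn-large u∉ u-touch ⟩
        # (inn u)                                            ≡⟨ #-succs (inn u) ⟨
        # (succs (inn u))                                    ≤⟨ #-subadditive {A = succs (inn u)}
                                                                  {｛ succ e ｝} {succs (inn u) ∖ ｛ succ e ｝} split ⟩
        # ｛ succ e ｝ + # (succs (inn u) ∖ ｛ succ e ｝)    ≤⟨ +-monoˡ-≤ _ (≤-trans (≤-reflexive (#-｛｝ (succ e)))
                                                                  (#-positive (out x) (xu , u∉))) ⟩
        # (out x) + # (succs (inn u) ∖ ｛ succ e ｝)         ≤⟨ #-∪ {A = out x} {succs (inn u) ∖ ｛ succ e ｝}
                                                                  (λ (_ , v∉) ((_ , pv∈) , _) → v∉ (pred∈⇒∈ pv∈)) ⟩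
        # A₁                                                 ∎
        where
        split : ∀ {v} → v ∈ succs (inn u) → v ∈ ｛ succ e ｝ ⊎ v ∈ succs (inn u) ∖ ｛ succ e ｝
        split {v} v∈ with v ≟ succ e
        ... | yes eq = inj₁ eq
        ... | no neq = inj₂ (v∈ , neq)
      -- A neighbour t of x off the cycle seeing succ e would, by alternation, give x ~ pred (pred e).
      out≁succ : ∀ {t} → t ∈ out x → ¬ t ~ succ e
      out≁succ {t} (xt , t∉) tse = no-longer (detour₂ u∉ x∉ (pred∈C e∈)
        (subst (u ~_) (sym (succ-pred e)) ue)
        (pred-of-other x∉ t∉ xt x-touch t-touch (pred∈C e∈) tpe
          (λ xpe → insert✗ x∉ (pred∈C e∈) xpe (subst (x ~_) (sym (succ-pred e)) xe)))
        (~-sym xu))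
        where
        t-touch : Touching t
        t-touch = succ e , succ∈C e∈ , tse
        tpe : t ~ pred e
        tpe = pred-of-other t∉ x∉ (~-sym xt) t-touch x-touch e∈ xe (λ te → insert✗ t∉ e∈ te tse)
      gap : ¬ (∃[ A ] out x ⊆ A × A ⊆ A₁ × # A ≡ a)
      gap (A , ⊆A , A⊆ , #A) = no-gap A (｛ succ e ｝ ∪ succs (X ∖ A)) #A
        (≤-trans
          (many-pushed x∉ u∉ xu A (succ e) (succ∈C e∈) (λ (_ , se∈A) → se∉A se∈A)
            (λ (xppse , ppse∈) → insert✗ x∉ ppse∈ xppse
              (subst (x ~_) (trans (sym (pred-succ e)) (sym (succ-pred (pred (succ e))))) xe)))
          (#-mono {A = (out x ∪ ｛ succ e ｝) ∪ (X ∩ A) ∪ succs (X ∖ A)} {A ∪ ｛ succ e ｝ ∪ succs (X ∖ A)}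
            λ { (inj₁ (inj₁ v∈)) → inj₁ (⊆A v∈) ; (inj₁ (inj₂ eq)) → inj₂ (inj₁ eq)
              ; (inj₂ (inj₁ (_ , v∈A))) → inj₁ v∈A ; (inj₂ (inj₂ v∈)) → inj₂ (inj₂ v∈) }))
        no-edge
        where
        se∉A : ¬ succ e ∈ A
        se∉A se∈A with A⊆ se∈A
        ... | inj₁ (_ , se∉)  = se∉ (succ∈C e∈)
        ... | inj₂ (_ , neq)  = neq refl
        no-edge : ∀ {y v} → y ∈ A → v ∈ ｛ succ e ｝ ∪ succs (X ∖ A) → ¬ y ~ v
        no-edge y∈A (inj₂ v∈) yv = no-edge-pushed x∉ u∉ xu A
          (λ w∈A → weaken (A⊆ w∈A)) y∈A v∈ yv
          where
          weaken : ∀ {w} → w ∈ A₁ → w ∈ out x ∪ succs (inn u)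
          weaken (inj₁ w∈)       = inj₁ w∈
          weaken (inj₂ (w∈ , _)) = inj₂ w∈
        no-edge {y} y∈A (inj₁ refl) yse with A⊆ y∈A
        ... | inj₁ y∈out = out≁succ y∈out yse
        ... | inj₂ ((upy , py∈) , y≢se) = no-longer (crossing u∉ py∈ e∈
                (λ eq → y≢se (trans (sym (succ-pred y)) (cong succ eq))) upy ue
                (subst (_~ succ e) (sym (succ-pred y)) yse))

    module _ {x v : Fin n} (x∉ : ¬ x ∈ C) (v∈ : v ∈ C) (xv : x ~ v) where

      private
        x-touch : Touching x
        x-touch = v , v∈ , xv

      partner-pred : ∀ {u} → u ∈ out x → Touching u → u ~ pred v
      partner-pred (xu , u∉) u-touch =
        pred-of-other u∉ x∉ (~-sym xu) u-touch x-touch v∈ xv (no-common x∉ u∉ xu v∈ xv)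

      -- Two uses of `pred-of-other` with exchanged roles: `x` sees `v`, hence its partner sees v⁻,
      -- hence `x` sees v⁻⁻.
      alternate : x ~ pred (pred v)
      alternate = via (partner x∉ x-touch)
        where
        via : ∃[ u ] u ∈ out x × Touching u → x ~ pred (pred v)
        via (u , u∈@(xu , u∉) , u-touch) =
          pred-of-other x∉ u∉ xu x-touch u-touch (pred∈C v∈) (partner-pred u∈ u-touch)
            (no-common u∉ x∉ (~-sym xu) (pred∈C v∈) (partner-pred u∈ u-touch))

    light-conclusion : ∀ {x} → ¬ x ∈ C → Touching x → IsBalancedCompleteBipartite G
    light-conclusion {x} x∉ touch@(v , v∈ , xv) = via (partner x∉ touch)
      where
      via : ∃[ u ] u ∈ out x × Touching u → IsBalancedCompleteBipartite G
      via (u , u∈ , u-touch) = Alternating.bipartite-graph alternate (proj₂ u∈) x∉ (pred∈C v∈)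
        (partner-pred x∉ v∈ xv u∈ u-touch) (subst (x ~_) (sym (succ-pred v)) xv)

    -- Otherwise no edge would leave `C`. Then `C` contains the neighbourhood of `c 0` and its
    -- complement that of `w`, so both are large enough to be joined.
    touching : ∀ {w} → ¬ w ∈ C → ∃[ x ] ¬ x ∈ C × Touching x
    touching {w} w∉ = decidable-stable (any? λ x → ¬? (mem? C x) ×-dec touching? x) λ none →
      gap none (subset C a (large none))
      where
      open ≤-Reasoning
      None : Set
      None = ¬ (∃[ x ] ¬ x ∈ C × Touching x)
      b≤#N : ∀ v → b ≤ # (N v)
      b≤#N v = ≤-pred (≤-trans (+-monoˡ-≤ b 0<a) (a+b≤1+#N v))
      large : None → a ≤ # C
      large none = begin
        a            ≤⟨ a≤b ⟩
        b            ≤⟨ b≤#N (c 0) ⟩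
        # (N (c 0))  ≤⟨ #-mono {A = N (c 0)} {C} (λ {v} c₀v → decidable-stable (mem? C v) λ v∉ →
                          none (v , v∉ , c 0 , c∈C 0 , ~-sym c₀v)) ⟩
        # C          ∎
      gap : None → ¬ (∃[ A ] A ⊆ C × # A ≡ a)
      gap none (A , A⊆ , #A) = no-gap A (∁ C) #A
        (begin
          a + b            ≤⟨ +-mono-≤ (≤-reflexive (sym #A)) (≤-trans (b≤#N w)
                                (#-mono {A = N w} {∁ C} λ wv v∈ → none (w , w∉ , _ , v∈ , wv))) ⟩
          # A + # (∁ C)    ≤⟨ #-∪ {A = A} {∁ C} (λ v∈A v∉ → v∉ (A⊆ v∈A)) ⟩
          # (A ∪ ∁ C)      ∎)
        λ v∈A x∉ vx → none (_ , x∉ , _ , A⊆ v∈A , ~-sym vx)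

  missed-vertex : 3 + l < n → ∃[ w ] ¬ w ∈ C
  missed-vertex ℓ<n = decidable-stable (any? λ w → ¬? (mem? C w)) λ none →
    <⇒≱ ℓ<n (injective⇒≤ (index-injective none))
    where
    on-cycle : ¬ (∃[ w ] ¬ w ∈ C) → ∀ v → v ∈ C
    on-cycle none v = decidable-stable (mem? C v) λ v∉ → none (v , v∉)
    index : ¬ (∃[ w ] ¬ w ∈ C) → Fin n → Fin (3 + l)
    index none v = fromℕ< (proj₁ (proj₂ (on-cycle none v)))
    index-injective : ∀ none {u v} → index none u ≡ index none v → u ≡ v
    index-injective none {u} {v} eq = trans (sym (proj₂ (proj₂ (on-cycle none u))))
      (trans (cong c (fromℕ<-injective _ _ (proj₁ (proj₂ (on-cycle none u))) (proj₁ (proj₂ (on-cycle none v))) eq))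
             (proj₂ (proj₂ (on-cycle none v))))

  conclusion : 3 + l < n → IsBalancedCompleteBipartite G
  conclusion ℓ<n with any? (λ v → mem? C v ×-dec (a ≤? # (out v)))
  ... | yes (v , v∈ , a≤) = Heavy.heavy-conclusion (backwards (λ z → a ≤ # (out z)) heavy-pred v∈ a≤)
  ... | no none = let _ , w∉ = missed-vertex ℓ<n
                      _ , x∉ , touch = L.touching w∉
                  in L.light-conclusion x∉ touch
    where
    module L = Light (λ {v} v∈ → ≰⇒> λ a≤ → none (v , v∈ , a≤))
 

-- From the minimum degree to all cycle lengths

δ≤degree : (G : Graph n) → ∀ v → δ G ≤ degree G v
δ≤degree {n} G v = All.lookup (min≤xs n _) (∈-map⁺ (degree G) (∈-allFin v))

joined-swap : {G : Graph n} {a b : ℕ} → AllPairsJoined G a b → AllPairsJoined G b a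
joined-swap {G = G} joined A B dis #A #B =
  let y , x , y∈ , x∈ , yx = joined B A (subst Sub.Empty (∩-comm A B) dis) #B #A
  in x , y , x∈ , y∈ , adj-sym G yx

ordered-split : {G : Graph n} {k : ℕ} → HasJoinedSplit G k →
                ∃[ a ] ∃[ b ] 0 < a × a ≤ b × a + b ≡ suc k × AllPairsJoined G a b
ordered-split {G = G} (a , b , 0<a , 0<b , a+b≡ , joined) with ≤-total a b
... | inj₁ a≤b = a , b , 0<a , a≤b , a+b≡ , joined
... | inj₂ b≤a = b , a , 0<b , b≤a , trans (+-comm b a) a+b≡ , joined-swap {G = G} joined

module Lengths (G : Graph (suc n)) (a b : ℕ) (0<a : 0 < a) (a≤b : a ≤ b)
               (joined : AllPairsJoined G a b) (large-degree : ∀ v → a + b ≤ suc (degree G v)) where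

  open Cycles G

  triangle-or-bipartite : Dec (HasCycle 3) → Cycle G 3 ⊎ IsBalancedCompleteBipartite G
  triangle-or-bipartite (yes cycle) = inj₁ (toCycle ≤-refl cycle)
  triangle-or-bipartite (no none)   = inj₂ (Joined.triangle-free G a b 0<a a≤b joined large-degree none zero)

  extend-or-bipartite : ∀ l → Cycle G (3 + l) → 3 + l < suc n → Dec (HasCycle (4 + l)) →
                        Cycle G (4 + l) ⊎ IsBalancedCompleteBipartite G
  extend-or-bipartite l _     _    (yes cycle) = inj₁ (toCycle (m≤m+n 3 (suc l)) cycle)
  extend-or-bipartite l cycle fits (no none)   =
    inj₂ (Extension.conclusion G a b 0<a a≤b joined large-degree (circuit cycle) none fits)

  -- For `j = 0` the premise on the shorter cycle is vacuous, and the triangle comes from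
  -- `triangle-free` instead.
  longer : ∀ j → (3 ≤ 2 + j → Cycle G (2 + j)) → 3 + j ≤ suc n →
           Cycle G (3 + j) ⊎ IsBalancedCompleteBipartite G
  longer zero    shorter fits = triangle-or-bipartite (hasCycle? 3)
  longer (suc l) shorter fits = extend-or-bipartite l (shorter (m≤m+n 3 l)) fits (hasCycle? (4 + l))

  -- The bound `ℓ ≤ suc n` lets the induction run past the number of vertices: it starts at length 2
  -- and ends at `2 + n`, one more than needed.
  LengthsUpTo : ℕ → Set
  LengthsUpTo m = ∀ ℓ → 3 ≤ ℓ → ℓ ≤ m → ℓ ≤ suc n → Cycle G ℓ

  add-length : ∀ m → LengthsUpTo m → (suc m ≤ suc n → Cycle G (suc m)) → LengthsUpTo (suc m)
  add-length m short cycle ℓ 3≤ℓ ℓ≤ ℓ≤n with m≤n⇒m<n∨m≡n ℓ≤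
  ... | inj₁ ℓ<   = short ℓ 3≤ℓ (≤-pred ℓ<) ℓ≤n
  ... | inj₂ refl = cycle ℓ≤n

  lengths-up-to : ∀ j → LengthsUpTo (2 + j) ⊎ IsBalancedCompleteBipartite G
  lengths-up-to zero = inj₁ λ ℓ 3≤ℓ ℓ≤2 _ → contradiction (≤-trans 3≤ℓ ℓ≤2) λ { (s≤s (s≤s ())) }
  lengths-up-to (suc j) = next (lengths-up-to j) (3 + j ≤? suc n)
    where
    next : LengthsUpTo (2 + j) ⊎ IsBalancedCompleteBipartite G → Dec (3 + j ≤ suc n) →
           LengthsUpTo (3 + j) ⊎ IsBalancedCompleteBipartite G
    next (inj₂ bip)   _          = inj₂ bip
    next (inj₁ short) (no ¬fits) = inj₁ (add-length (2 + j) short λ fits → contradiction fits ¬fits)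
    next (inj₁ short) (yes fits) =
      Sum.map₁ (λ cycle → add-length (2 + j) short λ _ → cycle)
        (longer j (λ 3≤ → short (2 + j) 3≤ ≤-refl (<⇒≤ fits)) fits)

  pancyclic-or-bipartite : Pancyclic G ⊎ IsBalancedCompleteBipartite G
  pancyclic-or-bipartite =
    Sum.map₁ (λ short ℓ 3≤ℓ ℓ≤n → short ℓ 3≤ℓ (m≤n⇒m≤1+n ℓ≤n) ℓ≤n) (lengths-up-to n)

pancyclic : ∀ n (G : Graph n) k → HasJoinedSplit G k → k ≤ δ G →
            Pancyclic G ⊎ IsBalancedCompleteBipartite G
pancyclic zero    G k _     _   = inj₁ λ ℓ 3≤ℓ ℓ≤0 → contradiction (≤-trans 3≤ℓ ℓ≤0) λ ()
pancyclic (suc n) G k split k≤δ = go (ordered-split {G = G} split)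
  where
  go : ∃[ a ] ∃[ b ] 0 < a × a ≤ b × a + b ≡ suc k × AllPairsJoined G a b →
       Pancyclic G ⊎ IsBalancedCompleteBipartite G
  go (a , b , 0<a , a≤b , a+b≡ , joined) = Lengths.pancyclic-or-bipartite G a b 0<a a≤b joined
    λ v → ≤-trans (≤-reflexive a+b≡) (s≤s (≤-trans k≤δ (δ≤degree G v)))

theorem1p2 : ∀ (n : ℕ) (G : Graph n) → δ G ≥ α̃ G →
    Pancyclic G ⊎ IsBalancedCompleteBipartite G
theorem1p2 n G δ≥α̃ = pancyclic n G (α̃ G) (proj₁ (α̃-isLeast G)) δ≥α̃
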